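{- Let $\mathcal{E}$ be a natural $t$-efficient error metric. There is a deterministic algorithm $\mathcal{A}_{\mathrm{InstanceOpt},\mathcal{E}}$ with the following guarantee. Given as input a $q$-query RDT $R$ over $n$ variables with description length $N$ and an error parameter $\varepsilon\in(0,1)$, let $$q^\star_{R,\mathcal{E}}:=\min\{\,q' : \text{there is a } q'\text{ -query DDT } D \text{ such that } \mathcal{E}(R,D)\le\varepsilon\,\}.$$ Then $\mathcal{A}_{\mathrm{InstanceOpt},\mathcal{E}}$ runs in time $\mathrm{poly}(N,t,n^{q^\star_{R,\mathcal{E}}})$ and returns a $q^\star_{R,\mathcal{E}}$-query DDT $D$ satisfying $\mathcal{E}(R,D)\le\varepsilon$.
   Context: An $n$-variable randomized decision tree (RDT) is a binary tree with two types of internal nodes: decision nodes, which branch on the value of one of the boolean variables $x_1,\dots,x_n$, and stochastic nodes, which branch on the outcome of an independent $\mathrm{Bernoulli}(\frac12)$ random bit. Leaves are labelled by values in $[0,1]$. Its query complexity is the maximum number of decision nodes on any root-to-leaf path, and its randomness complexity is the maximum number $m$ of stochastic nodes on any root-to-leaf path; it is $q$-query if its query complexity is at most $q$. The RDT computes a function $R:\{0,1\}^n\times\{0,1\}^m\to[0,1]$, where $R(x,r)$ is the label of the leaf reached on input $x$ when the stochastic nodes encountered branch according to the bits of $r$. Its mean function is $\mu_R(x)=\mathbb{E}_{r\sim\{0,1\}^m}[R(x,r)]$ ($r$ uniform). A deterministic decision tree (DDT) is an RDT with no stochastic nodes, computing $D:\{0,1\}^n\to[0,1]$. The description length is the length of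 the description of the tree. An error metric is a map $\mathcal{E}:\{\text{RDTs}\}\times\{\text{DDTs}\}\to[0,1]$. It is natural if there is some $d:[0,1]\times[0,1]\to[0,1]$ such that $\mathcal{E}(R,D)=\mathbb{E}_{x}[d(\mu_R(x),D(x))]$ for uniform $x\sim\{0,1\}^n$. For $t=t(q)$ a function of $q$, $\mathcal{E}$ is $t$-efficient if for all $q$-query RDTs $R$ and DDTs $D$ of description lengths $N_R$ and $N_D$ respectively: (1) there is a deterministic $\mathrm{poly}(t,N_R,N_D)$-time algorithm that computes $\mathcal{E}(R,D)$; (2) there is a deterministic $\mathrm{poly}(t,N_R)$-time algorithm that computes the constant $c\in[0,1]$ minimizing $\mathcal{E}(R,c)$.
   Formalization: Leaf labels, ε, d, the errors and the best constant are rational numbers in [0,1] instead of reals, and the running time is poly(N, t, n^{q*}, |ε|), where |ε| is the bit length of the input ε, which any algorithm reading ε exactly must pay. -}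

module Defs where

open import Data.Bool.Base using (Bool; true; false; if_then_else_)
open import Data.Fin.Base using (Fin; toℕ)
open import Data.Integer.Base as ℤ using (ℤ; +_; -[1+_])
open import Data.Nat.Base as ℕ using (ℕ; suc; _⊔_; _^_; z≤n; s≤s)
open import Data.Nat.Binary.Base as Bin using (ℕᵇ; 2[1+_]; 1+[2_])
open import Data.Nat.Properties as ℕₚ using (m⊔n≤o⇒m≤o; m⊔n≤o⇒n≤o; m^n≢0)
open import Data.Product.Base using (Σ-syntax; ∃-syntax; _×_; _,_)
open import Data.Rational.Base as ℚ using (ℚ; 0ℚ; 1ℚ; ↥_; ↧ₙ_)
open import Data.Rational.Properties as ℚₚ using ()
open import Data.Rational.Unnormalised.Base as ℚᵘ using (mkℚᵘ; *≡*)
open import Data.Rational.Unnormalised.Properties as ℚᵘₚ using ()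
import Data.Integer.Properties as ℤₚ
open import Data.Vec.Base using (Vec; []; _∷_; lookup)
open import Relation.Binary.PropositionalEquality
  using (_≡_; refl; sym; trans; cong; cong₂; subst)

-- Labels, errors and the error parameter have to be written down by
-- algorithms, so they are rational.
record [0,1] : Set where
  constructor unit
  field
    value : ℚ
    0≤value : 0ℚ ℚ.≤ value
    value≤1 : value ℚ.≤ 1ℚ

open [0,1] public

∑ : ∀ m → (Vec Bool m → ℚ) → ℚ
∑ 0       f = f []
∑ (suc m) f = ∑ m (λ r → f (false ∷ r)) ℚ.+ ∑ m (λ r → f (true ∷ r))

2^-_ : ℕ → ℚ
2^- m = ℚ._/_ (+ 1) (2 ^ m) {{m^n≢0 2 m}}

𝔼 : ∀ {m} → (Vec Bool m → ℚ) → ℚ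
𝔼 {m} f = ∑ m f ℚ.* 2^- m

-- The first subtree of an internal node is taken when the variable or
-- random bit is 0 (false), the second when it is 1 (true).
data RDT (n : ℕ) : Set where
  leaf  : [0,1] → RDT n
  query : Fin n → RDT n → RDT n → RDT n
  coin  : RDT n → RDT n → RDT n

module _ {n : ℕ} where

  queries : RDT n → ℕ
  queries (leaf _)        = 0
  queries (query _ T₀ T₁) = suc (queries T₀ ⊔ queries T₁)
  queries (coin T₀ T₁)    = queries T₀ ⊔ queries T₁

  randomness : RDT n → ℕ
  randomness (leaf _)        = 0
  randomness (query _ T₀ T₁) = randomness T₀ ⊔ randomness T₁
  randomness (coin T₀ T₁)    = suc (randomness T₀ ⊔ randomness T₁)

  -- The k-th stochastic node met on a path branches on the k-th random
  -- bit; bits left over at a leaf are ignored.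
  run : (T : RDT n) → Vec Bool n →
        ∀ {m} → randomness T ℕ.≤ m → Vec Bool m → [0,1]
  run (leaf v)        x _ _ = v
  run (query i T₀ T₁) x h r =
    if lookup x i
    then run T₁ x (m⊔n≤o⇒n≤o (randomness T₀) (randomness T₁) h) r
    else run T₀ x (m⊔n≤o⇒m≤o (randomness T₀) (randomness T₁) h) r
  run (coin T₀ T₁) x (s≤s h) (b ∷ r) =
    if b
    then run T₁ x (m⊔n≤o⇒n≤o (randomness T₀) (randomness T₁) h) r
    else run T₀ x (m⊔n≤o⇒m≤o (randomness T₀) (randomness T₁) h) r

  ⟦_⟧ᴿ : (R : RDT n) → Vec Bool n → Vec Bool (randomness R) → [0,1]
  ⟦ R ⟧ᴿ x r = run R x ℕₚ.≤-refl r

ℕ⇒ℚ : ℕ → ℚ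
ℕ⇒ℚ k = + k ℚ./ 1

ℕ⇒ℚ-+ : ∀ a b → ℕ⇒ℚ (a ℕ.+ b) ≡ ℕ⇒ℚ a ℚ.+ ℕ⇒ℚ b
ℕ⇒ℚ-+ a b = ℚₚ.toℚᵘ-injective
  (ℚᵘₚ.≃-trans (ℚₚ.toℚᵘ-fromℚᵘ (mkℚᵘ (+ (a ℕ.+ b)) 0))
  (ℚᵘₚ.≃-trans (*≡* (cong (ℤ._* + 1)
                  (sym (cong₂ ℤ._+_ (ℤₚ.*-identityʳ (+ a))
                                                    (ℤₚ.*-identityʳ (+ b))))))
  (ℚᵘₚ.≃-trans (ℚᵘₚ.+-cong
                  (ℚᵘₚ.≃-sym (ℚₚ.toℚᵘ-fromℚᵘ (mkℚᵘ (+ a) 0)))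
                  (ℚᵘₚ.≃-sym (ℚₚ.toℚᵘ-fromℚᵘ (mkℚᵘ (+ b) 0))))
               (ℚᵘₚ.≃-sym (ℚₚ.toℚᵘ-homo-+ (ℕ⇒ℚ a) (ℕ⇒ℚ b))))))

∑-nonneg : ∀ m (f : Vec Bool m → [0,1]) → 0ℚ ℚ.≤ ∑ m (λ r → value (f r))
∑-nonneg 0       f = 0≤value (f [])
∑-nonneg (suc m) f =
  ℚₚ.+-mono-≤ (∑-nonneg m (λ r → f (false ∷ r))) (∑-nonneg m (λ r → f (true ∷ r)))

∑-upper : ∀ m (f : Vec Bool m → [0,1]) →
          ∑ m (λ r → value (f r)) ℚ.≤ ℕ⇒ℚ (2 ^ m)
∑-upper 0       f = value≤1 (f [])
∑-upper (suc m) f = subst (∑ (suc m) (λ r → value (f r)) ℚ.≤_) (sym double)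
  (ℚₚ.+-mono-≤ (∑-upper m (λ r → f (false ∷ r))) (∑-upper m (λ r → f (true ∷ r))))
  where
  double : ℕ⇒ℚ (2 ^ suc m) ≡ ℕ⇒ℚ (2 ^ m) ℚ.+ ℕ⇒ℚ (2 ^ m)
  double = trans (cong (λ k → ℕ⇒ℚ (2 ^ m ℕ.+ k)) (ℕₚ.+-identityʳ (2 ^ m)))
                 (ℕ⇒ℚ-+ (2 ^ m) (2 ^ m))

ℕ⇒ℚ-inverse : ∀ k .{{_ : ℕ.NonZero k}} → ℕ⇒ℚ k ℚ.* (+ 1 ℚ./ k) ≡ 1ℚ
ℕ⇒ℚ-inverse k@(suc k-1) = ℚₚ.toℚᵘ-injective
  (ℚᵘₚ.≃-trans (ℚₚ.toℚᵘ-homo-* (ℕ⇒ℚ k) (+ 1 ℚ./ k))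
  (ℚᵘₚ.≃-trans (ℚᵘₚ.*-cong (ℚₚ.toℚᵘ-fromℚᵘ (mkℚᵘ (+ k) 0))
                            (ℚₚ.toℚᵘ-fromℚᵘ (mkℚᵘ (+ 1) k-1)))
               (*≡* (trans (ℤₚ.*-identityʳ _)
                    (trans (ℤₚ.*-identityʳ (+ k))
                           (sym (trans (ℤₚ.*-identityˡ _)
                                       (cong (λ j → + suc j) (ℕₚ.+-identityʳ k-1)))))))))

𝔼-unit : ∀ {m} → (Vec Bool m → [0,1]) → [0,1]
𝔼-unit {m} f = unit (𝔼 (λ r → value (f r)))
  (subst (ℚ._≤ 𝔼 (λ r → value (f r))) (ℚₚ.*-zeroˡ (2^- m))
         (ℚₚ.*-monoʳ-≤-nonNeg (2^- m) (∑-nonneg m f)))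
  (subst (𝔼 (λ r → value (f r)) ℚ.≤_) (ℕ⇒ℚ-inverse (2 ^ m))
         (ℚₚ.*-monoʳ-≤-nonNeg (2^- m) (∑-upper m f)))
  where
  instance
    2^m≢0 : ℕ.NonZero (2 ^ m)
    2^m≢0 = m^n≢0 2 m
    2^-m≥0 : ℚ.NonNegative (2^- m)
    2^-m≥0 = ℚₚ.normalize-nonNeg 1 (2 ^ m)

μ : ∀ {n} → RDT n → Vec Bool n → [0,1]
μ R x = 𝔼-unit (⟦ R ⟧ᴿ x)

data CoinFree {n : ℕ} : RDT n → Set where
  leaf  : ∀ {v} → CoinFree (leaf v)
  query : ∀ {i T₀ T₁} → CoinFree T₀ → CoinFree T₁ → CoinFree (query i T₀ T₁)

record DDT (n : ℕ) : Set where
  constructor ddt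
  field
    tree     : RDT n
    coinFree : CoinFree tree

open DDT public

randomness-coinFree : ∀ {n} {T : RDT n} → CoinFree T → randomness T ≡ 0
randomness-coinFree leaf          = refl
randomness-coinFree (query c₀ c₁) =
  cong₂ _⊔_ (randomness-coinFree c₀) (randomness-coinFree c₁)

⟦_⟧ᴰ : ∀ {n} → DDT n → Vec Bool n → [0,1]
⟦ D ⟧ᴰ x = run (tree D) x (ℕₚ.≤-reflexive (randomness-coinFree (coinFree D))) []

const : ∀ {n} → [0,1] → DDT n
const c = ddt (leaf c) leaf

-- Programs (Expr below) are first-order recursive functions on these trees.
data Tree : Set where
  nil  : Tree
  cons : Tree → Tree → Tree

size : Tree → ℕ
size nil        = 1
size (cons u v) = suc (size u ℕ.+ size v)

-- Variables are de Bruijn indices.  `call p e` applies the closed program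
-- p, and `self e` applies the program in whose body it occurs.
data Expr : ℕ → Set where
  var  : ∀ {k} → Fin k → Expr k
  nil  : ∀ {k} → Expr k
  cons : ∀ {k} → Expr k → Expr k → Expr k
  case : ∀ {k} → Expr k → Expr k → Expr (2 ℕ.+ k) → Expr k
  let′ : ∀ {k} → Expr k → Expr (suc k) → Expr k
  call : ∀ {k} → Expr 1 → Expr k → Expr k
  self : ∀ {k} → Expr k → Expr k

Program : Set
Program = Expr 1

-- p ∣ ρ ⊢ e ⇓ v [ t ]: inside program p and environment ρ, e evaluates
-- to v in time t.  Reading a variable is charged the size of the tree
-- copied, as unit cost would let `cons x x` build trees of exponential size
-- in linear time; with this charge the model is polynomial-time equivalent
-- to deterministic Turing machines.
infix 4 _∣_⊢_⇓_[_]

data _∣_⊢_⇓_[_] (p : Program) {k : ℕ} (ρ : Vec Tree k) :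
                Expr k → Tree → ℕ → Set where
  ⇓var  : ∀ i → p ∣ ρ ⊢ var i ⇓ lookup ρ i [ size (lookup ρ i) ]
  ⇓nil  : p ∣ ρ ⊢ nil ⇓ nil [ 1 ]
  ⇓cons : ∀ {e₁ e₂ u v s t} →
          p ∣ ρ ⊢ e₁ ⇓ u [ s ] → p ∣ ρ ⊢ e₂ ⇓ v [ t ] →
          p ∣ ρ ⊢ cons e₁ e₂ ⇓ cons u v [ suc (s ℕ.+ t) ]
  ⇓case-nil  : ∀ {e e₁ e₂ v s t} →
               p ∣ ρ ⊢ e ⇓ nil [ s ] → p ∣ ρ ⊢ e₁ ⇓ v [ t ] →
               p ∣ ρ ⊢ case e e₁ e₂ ⇓ v [ suc (s ℕ.+ t) ]
  ⇓case-cons : ∀ {e e₁ e₂ a b v s t} →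
               p ∣ ρ ⊢ e ⇓ cons a b [ s ] → p ∣ a ∷ b ∷ ρ ⊢ e₂ ⇓ v [ t ] →
               p ∣ ρ ⊢ case e e₁ e₂ ⇓ v [ suc (s ℕ.+ t) ]
  ⇓let  : ∀ {e₁ e₂ u v s t} →
          p ∣ ρ ⊢ e₁ ⇓ u [ s ] → p ∣ u ∷ ρ ⊢ e₂ ⇓ v [ t ] →
          p ∣ ρ ⊢ let′ e₁ e₂ ⇓ v [ suc (s ℕ.+ t) ]
  ⇓call : ∀ {p′ e u v s t} →
          p ∣ ρ ⊢ e ⇓ u [ s ] → p′ ∣ u ∷ [] ⊢ p′ ⇓ v [ t ] →
          p ∣ ρ ⊢ call p′ e ⇓ v [ suc (s ℕ.+ t) ]
  ⇓self : ∀ {e u v s t} →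
          p ∣ ρ ⊢ e ⇓ u [ s ] → p ∣ u ∷ [] ⊢ p ⇓ v [ t ] →
          p ∣ ρ ⊢ self e ⇓ v [ suc (s ℕ.+ t) ]

_on_returns_within_ : Program → Tree → Tree → ℕ → Set
p on u returns v within b = ∃[ t ] (p ∣ u ∷ [] ⊢ p ⇓ v [ t ]) × t ℕ.≤ b

-- A quantity is poly(a₁,…,aₖ) if it is bounded by ⟦ P ⟧ᴾ (a₁ ∷ … ∷ aₖ ∷ [])
-- for some P : Poly k.
infixl 6 _⊕_
infixl 7 _⊗_

data Poly (k : ℕ) : Set where
  con     : ℕ → Poly k
  var     : Fin k → Poly k
  _⊕_ _⊗_ : Poly k → Poly k → Poly k

⟦_⟧ᴾ : ∀ {k} → Poly k → Vec ℕ k → ℕ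
⟦ con c ⟧ᴾ a = c
⟦ var i ⟧ᴾ a = lookup a i
⟦ P ⊕ Q ⟧ᴾ a = ⟦ P ⟧ᴾ a ℕ.+ ⟦ Q ⟧ᴾ a
⟦ P ⊗ Q ⟧ᴾ a = ⟦ P ⟧ᴾ a ℕ.* ⟦ Q ⟧ᴾ a

-- ℕᵇ is bijective binary, so encℕ k has size logarithmic in k.
encᵇ : ℕᵇ → Tree
encᵇ Bin.zero = nil
encᵇ 2[1+ b ] = cons (cons nil nil) (encᵇ b)
encᵇ 1+[2 b ] = cons nil (encᵇ b)

encℕ : ℕ → Tree
encℕ k = encᵇ (Bin.fromℕ k)

encℤ : ℤ → Tree
encℤ (+ k)    = cons nil (encℕ k)
encℤ -[1+ k ] = cons (cons nil nil) (encℕ k)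

encℚ : ℚ → Tree
encℚ p = cons (encℤ (↥ p)) (encℕ (↧ₙ p))

encRDT : ∀ {n} → RDT n → Tree
encRDT (leaf v)        = cons (encℕ 0) (encℚ (value v))
encRDT (query i T₀ T₁) = cons (encℕ 1) (cons (encℕ (toℕ i)) (cons (encRDT T₀) (encRDT T₁)))
encRDT (coin T₀ T₁)    = cons (encℕ 2) (cons (encRDT T₀) (encRDT T₁))

-- The description of an n-variable tree also states n, in binary.
describe : ∀ {n} → RDT n → Tree
describe {n} T = cons (encℕ n) (encRDT T)

descriptionLength : ∀ {n} → RDT n → ℕ
descriptionLength T = size (describe T)

ErrorMetric : Set
ErrorMetric = ∀ {n} → RDT n → DDT n → [0,1]

Natural : ErrorMetric → Set
Natural 𝓔 = Σ[ d ∈ ([0,1] → [0,1] → [0,1]) ]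
  ∀ {n} (R : RDT n) (D : DDT n) →
  value (𝓔 R D) ≡ 𝔼 (λ x → value (d (μ R x) (⟦ D ⟧ᴰ x)))

-- One algorithm and one polynomial serve all n, q, R and D; t is evaluated at
-- any upper bound q on the query complexity of R.
record Efficient (t : ℕ → ℕ) (𝓔 : ErrorMetric) : Set where
  field
    evaluate : ∃[ A ] Σ[ P ∈ Poly 3 ]
      ∀ {n} q (R : RDT n) (D : DDT n) → queries R ℕ.≤ q →
      A on cons (describe R) (describe (tree D))
        returns encℚ (value (𝓔 R D))
        within ⟦ P ⟧ᴾ (t q ∷ descriptionLength R ∷ descriptionLength (tree D) ∷ [])

    bestConstant : ∃[ A ] Σ[ P ∈ Poly 2 ]
      ∀ {n} q (R : RDT n) → queries R ℕ.≤ q →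
      Σ[ c ∈ [0,1] ]
        (∀ c′ → value (𝓔 R (const c)) ℚ.≤ value (𝓔 R (const c′))) ×
        A on describe R returns encℚ (value c)
          within ⟦ P ⟧ᴾ (t q ∷ descriptionLength R ∷ [])

Achievable : ErrorMetric → ∀ {n} → RDT n → ℚ → ℕ → Set
Achievable 𝓔 {n} R ε q′ =
  Σ[ D ∈ DDT n ] queries (tree D) ℕ.≤ q′ × value (𝓔 R D) ℚ.≤ ε

record IsMinimum (S : ℕ → Set) (k : ℕ) : Set where
  field
    member : S k
    least  : ∀ {j} → S j → k ℕ.≤ j

{-# OPTIONS --safe #-}
module Submission where

-- Call E the error metric.  The algorithm is a recursion on the depth: an
-- optimal tree of depth k + 1 for R is either the best constant or a query
-- of some variable i above optimal trees of depth k for the restrictions of R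
-- to i = 0 and i = 1.  It is run for k = 0, 1, 2, ... until the error of the
-- optimal tree is at most ε, which happens at k = q⋆.
--
-- Correctness.  As E is natural, E(R,D) is the average over the inputs x of
-- d(mean of R at x, D(x)).  Splitting the cube along variable i gives
-- 2 E(R, query i D₀ D₁) = E(R₀, D₀′) + E(R₁, D₁′), where R_b is the restriction
-- of R and D_b′ is D_b made to ignore i (error-query).  Ignoring i does not
-- change the error of an optimal tree for R_b (forget-optimal), so optimal
-- subtrees make an optimal tree (query-optimal), and comparing all i finds the
-- optimum (better-optimal).  To compare the variables one by one, the recursion
-- works on a stack of lists of variables, one list per level, and removes the
-- first variable of the top list or the whole top list.
--
-- Time.  With n variables left at each of k levels there are at most
-- (1 + 3n)^k activations (calls-fullStack).  For k ≤ q⋆ this is polynomial in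
-- n^q⋆: if n ≥ 2 then 1 + 3n ≤ n³, and if n ≤ 1 then q⋆ ≤ n, since a repeated
-- query is useless (dominated, minimum-0, minimum-1).  Each activation runs
-- the given programs for evaluation and for the best constant, a restriction,
-- and a comparison of rationals by cross multiplication in binary.  All trees
-- that occur have polynomial size, so each activation takes polynomial time
-- (Build.build).
--
-- The programs are analysed with an amortised evaluation relation: if s bounds
-- the sizes of the values in the environment and the times of the calls to
-- other programs, then c activations of a program p take time at most
-- c * (weight p * s) (⇓-time, activate).

open import Defs
open import Algebra.Bundles using (CommutativeMonoid)
open import Data.Bool.Base using (Bool; true; false; if_then_else_)
open import Data.Bool.Properties using (if-eta)
open import Data.Fin.Base using (Fin; zero; suc; toℕ; fromℕ<)
import Data.Fin.Properties as Finₚ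
import Data.Integer.Base as ℤ
import Data.Integer.Properties as ℤₚ
open import Data.List.Base using (List; []; _∷_; length; replicate)
open import Data.List.Membership.Propositional using (_∈_)
import Data.List.Properties as Listₚ
open import Data.List.Relation.Unary.Any as Any using ()
open import Data.Nat.Base as ℕ
  using (ℕ; zero; suc; _+_; _*_; _≤_; _<_; _^_; _⊔_; z≤n; s≤s)
open import Data.Nat.Binary.Base as Bin using (ℕᵇ; zero; 2[1+_]; 1+[2_])
import Data.Nat.Binary.Properties as Binₚ
open import Data.Nat.Properties
open import Data.Nat.Tactic.RingSolver using (solve-∀)
open import Data.Product.Base using (Σ-syntax; ∃-syntax; _×_; _,_; proj₁; proj₂)
open import Data.Rational.Base as ℚ using (ℚ; 0ℚ; 1ℚ; ½; mkℚ)
import Data.Rational.Properties as ℚₚ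
open import Data.Sum.Base using (inj₁; inj₂)
open import Data.Vec.Base using (Vec; []; _∷_; lookup; _[_]≔_)
import Data.Vec.Properties as Vecₚ
open import Data.Vec.Relation.Binary.Pointwise.Inductive as Pointwise
  using (Pointwise; []; _∷_)
open import Data.Vec.Relation.Unary.All using (All; []; _∷_)
import Data.Vec.Relation.Unary.All.Properties as All
open import Relation.Nullary using (Dec; does; yes; no; contradiction)
open import Relation.Nullary.Decidable using (dec-true; dec-false)
open import Relation.Binary.PropositionalEquality
  using (_≡_; refl; sym; trans; cong; cong₂; subst; subst₂; module ≡-Reasoning)

open import Algebra.Properties.CommutativeSemigroup
  (CommutativeMonoid.commutativeSemigroup ℚₚ.+-0-commutativeMonoid) using (interchange)

-- Counting time

-- v0, v1, ... are the program variables by their distance from the innermost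
-- binder.  A cons-branch of case binds the head as v0 and the tail as v1, so
-- it shifts the older variables by two; let′ shifts them by one.
index : ∀ m {k} → Fin (suc m + k)
index zero    = zero
index (suc m) = suc (index m)

v0 : ∀ {k} → Expr (1 + k)
v0 = var (index 0)
v1 : ∀ {k} → Expr (2 + k)
v1 = var (index 1)
v2 : ∀ {k} → Expr (3 + k)
v2 = var (index 2)
v3 : ∀ {k} → Expr (4 + k)
v3 = var (index 3)
v4 : ∀ {k} → Expr (5 + k)
v4 = var (index 4)
v5 : ∀ {k} → Expr (6 + k)
v5 = var (index 5)
v6 : ∀ {k} → Expr (7 + k)
v6 = var (index 6)
v7 : ∀ {k} → Expr (8 + k)
v7 = var (index 7)
v8 : ∀ {k} → Expr (9 + k)
v8 = var (index 8)
v9 : ∀ {k} → Expr (10 + k)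
v9 = var (index 9)
v10 : ∀ {k} → Expr (11 + k)
v10 = var (index 10)
v11 : ∀ {k} → Expr (12 + k)
v11 = var (index 11)
v13 : ∀ {k} → Expr (14 + k)
v13 = var (index 13)
v15 : ∀ {k} → Expr (16 + k)
v15 = var (index 15)

-- A bound on the number of evaluation steps of one execution of e, not counting
-- the inside of calls: every node is visited at most once.  A call counts one
-- extra, paying for the called program.
weight : ∀ {k} → Expr k → ℕ
weight (var i)       = 1
weight nil           = 1
weight (cons e f)    = suc (weight e + weight f)
weight (case e f g)  = suc (weight e + (weight f + weight g))
weight (let′ e f)    = suc (weight e + weight f)
weight (call p e)    = suc (suc (weight e))
weight (self e)      = suc (weight e)

size-≥1 : ∀ u → 1 ≤ size u
size-≥1 nil        = s≤s z≤n
size-≥1 (cons u v) = s≤s z≤n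

-- Building a value takes at least as long as its size, because reading a
-- variable is charged.  Hence time bounds on calls are also size bounds.
size≤time : ∀ {p k} {ρ : Vec Tree k} {e v t} → p ∣ ρ ⊢ e ⇓ v [ t ] → size v ≤ t
size≤time (⇓var i)           = ≤-refl
size≤time ⇓nil               = ≤-refl
size≤time (⇓cons d₁ d₂)      = s≤s (+-mono-≤ (size≤time d₁) (size≤time d₂))
size≤time (⇓case-nil _ d)    = m≤n⇒m≤1+n (m≤n⇒m≤o+n _ (size≤time d))
size≤time (⇓case-cons _ d)   = m≤n⇒m≤1+n (m≤n⇒m≤o+n _ (size≤time d))
size≤time (⇓let _ d)         = m≤n⇒m≤1+n (m≤n⇒m≤o+n _ (size≤time d))
size≤time (⇓call _ d)        = m≤n⇒m≤1+n (m≤n⇒m≤o+n _ (size≤time d))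
size≤time (⇓self _ d)        = m≤n⇒m≤1+n (m≤n⇒m≤o+n _ (size≤time d))

output-size : ∀ {p u v b} → p on u returns v within b → size v ≤ b
output-size (_ , d , t≤b) = ≤-trans (size≤time d) t≤b

weaken : ∀ {p u v b c} → b ≤ c → p on u returns v within b → p on u returns v within c
weaken b≤c (t , d , t≤b) = t , d , ≤-trans t≤b b≤c

-- p at s on u returns v after c: a run of p on u consisting of at most c
-- activations of p, each charged s per node of its body.  A record, so that
-- c can be recovered from the type by unification.
record _at_on_returns_after_ (p : Program) (s : ℕ) (u v : Tree) (c : ℕ) : Set where
  constructor counted
  field
    runs : p on u returns v within (c * (weight p * s))

open _at_on_returns_after_

after-≤ : ∀ {p s u v c d} → c ≤ d → p at s on u returns v after c → p at s on u returns v after d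
after-≤ {p} {s} c≤d r = counted (weaken (*-monoˡ-≤ (weight p * s) c≤d) (runs r))

-- p at s ∣ ρ ⊢ e ⇓ v ⟨ c ⟩: evaluation with amortised time.  The number s is
-- meant to bound the size of everything in the environment and the time of
-- every call to another program; c counts the activations of p reached
-- through self.  With these conventions a derivation carries no arithmetic
-- beyond the addition of activation counts.
infix 4 _at_∣_⊢_⇓_⟨_⟩

data _at_∣_⊢_⇓_⟨_⟩ (p : Program) (s : ℕ) {k : ℕ} (ρ : Vec Tree k) :
                    Expr k → Tree → ℕ → Set where
  ↓var  : ∀ i → p at s ∣ ρ ⊢ var i ⇓ lookup ρ i ⟨ 0 ⟩
  ↓nil  : p at s ∣ ρ ⊢ nil ⇓ nil ⟨ 0 ⟩
  ↓cons : ∀ {e f u v c d} →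
          p at s ∣ ρ ⊢ e ⇓ u ⟨ c ⟩ → p at s ∣ ρ ⊢ f ⇓ v ⟨ d ⟩ →
          p at s ∣ ρ ⊢ cons e f ⇓ cons u v ⟨ c + d ⟩
  ↓case-nil  : ∀ {i f g v c} → lookup ρ i ≡ nil →
               p at s ∣ ρ ⊢ f ⇓ v ⟨ c ⟩ →
               p at s ∣ ρ ⊢ case (var i) f g ⇓ v ⟨ c ⟩
  ↓case-cons : ∀ {i f g a b v c} → lookup ρ i ≡ cons a b →
               p at s ∣ a ∷ b ∷ ρ ⊢ g ⇓ v ⟨ c ⟩ →
               p at s ∣ ρ ⊢ case (var i) f g ⇓ v ⟨ c ⟩
  ↓let  : ∀ {e f u v c d} → size u ≤ s →
          p at s ∣ ρ ⊢ e ⇓ u ⟨ c ⟩ → p at s ∣ u ∷ ρ ⊢ f ⇓ v ⟨ d ⟩ →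
          p at s ∣ ρ ⊢ let′ e f ⇓ v ⟨ c + d ⟩
  ↓call : ∀ {p′ e u v c} →
          p at s ∣ ρ ⊢ e ⇓ u ⟨ c ⟩ → p′ on u returns v within s →
          p at s ∣ ρ ⊢ call p′ e ⇓ v ⟨ c ⟩
  ↓self : ∀ {e u v c d} →
          p at s ∣ ρ ⊢ e ⇓ u ⟨ c ⟩ → p at s on u returns v after d →
          p at s ∣ ρ ⊢ self e ⇓ v ⟨ c + d ⟩

private
  -- The time of a node with two subterms, where W is the time of an activation.
  join : ∀ {a b} w x c d s W → a ≤ w * s + c * W → b ≤ x * s + d * W → 1 ≤ s →
         suc (a + b) ≤ suc (w + x) * s + (c + d) * W
  join {a} {b} w x c d s W p q 1≤s =
    ≤-trans (+-mono-≤ 1≤s (+-mono-≤ p q)) (≤-reflexive (eq w x c d s W))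
    where
    eq : ∀ w x c d s W → s + ((w * s + c * W) + (x * s + d * W)) ≡
                         suc (w + x) * s + (c + d) * W
    eq = solve-∀

  grow : ∀ {a} w x y c s W → a ≤ suc (w + x) * s + c * W → x ≤ y →
         a ≤ suc (w + y) * s + c * W
  grow w x y c s W p x≤y = ≤-trans p
    (+-monoˡ-≤ (c * W) (*-monoˡ-≤ s (s≤s (+-monoʳ-≤ w x≤y))))

  unfold-cons : ∀ {s a b u} → size u ≤ s → u ≡ cons a b → size a ≤ s × size b ≤ s
  unfold-cons {a = a} {b} h refl =
    ≤-trans (m≤n⇒m≤1+n (m≤m+n _ _)) h , ≤-trans (m≤n⇒m≤1+n (m≤n+m (size b) (size a))) h

-- The amortised derivation is sound for the time of the model.
⇓-time : ∀ {p s k} {ρ : Vec Tree k} {e v c} → 1 ≤ s → All (λ u → size u ≤ s) ρ →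
         p at s ∣ ρ ⊢ e ⇓ v ⟨ c ⟩ →
         ∃[ t ] (p ∣ ρ ⊢ e ⇓ v [ t ]) × t ≤ weight e * s + c * (weight p * s)
⇓-time {p} {s} 1≤s ok (↓var i) =
  _ , ⇓var i , ≤-trans (All.lookup⁺ ok i) (≤-trans (m≤m+n s 0) (m≤m+n _ _))
⇓-time 1≤s ok ↓nil = 1 , ⇓nil , ≤-trans 1≤s (≤-trans (m≤m+n _ 0) (m≤m+n _ _))
⇓-time {p} {s} 1≤s ok (↓cons {e} {f} {c = c} {d} D E)
  with t , D′ , t≤ ← ⇓-time 1≤s ok D | u , E′ , u≤ ← ⇓-time 1≤s ok E =
  _ , ⇓cons D′ E′ , join (weight e) (weight f) c d s _ t≤ u≤ 1≤s
⇓-time {p} {s} {ρ = ρ} 1≤s ok (↓case-nil {i} {f} {g} {c = c} eq E)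
  with u , E′ , u≤ ← ⇓-time 1≤s ok E =
  _ , ⇓case-nil (subst (λ v → p ∣ ρ ⊢ var i ⇓ v [ size (lookup ρ i) ]) eq (⇓var i)) E′ ,
  grow 1 (weight f) (weight f + weight g) c s _
    (join 1 (weight f) 0 c s _ (≤-trans (All.lookup⁺ ok i) (≤-trans (m≤m+n s 0) (m≤m+n _ 0)))
      u≤ 1≤s)
    (m≤m+n _ _)
⇓-time {p} {s} {ρ = ρ} 1≤s ok (↓case-cons {i} {f} {g} {c = c} eq E)
  with sa , sb ← unfold-cons (All.lookup⁺ ok i) eq
  with u , E′ , u≤ ← ⇓-time 1≤s (sa ∷ sb ∷ ok) E =
  _ , ⇓case-cons (subst (λ v → p ∣ ρ ⊢ var i ⇓ v [ size (lookup ρ i) ]) eq (⇓var i)) E′ ,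
  grow 1 (weight g) (weight f + weight g) c s _
    (join 1 (weight g) 0 c s _ (≤-trans (All.lookup⁺ ok i) (≤-trans (m≤m+n s 0) (m≤m+n _ 0)))
      u≤ 1≤s)
    (m≤n+m _ _)
⇓-time {p} {s} 1≤s ok (↓let {e} {f} {c = c} {d} small D E)
  with t , D′ , t≤ ← ⇓-time 1≤s ok D | u , E′ , u≤ ← ⇓-time 1≤s (small ∷ ok) E =
  _ , ⇓let D′ E′ , join (weight e) (weight f) c d s _ t≤ u≤ 1≤s
⇓-time {p} {s} 1≤s ok (↓call {e = e} {c = c} D (u , E , u≤))
  with t , D′ , t≤ ← ⇓-time 1≤s ok D =
  _ , ⇓call D′ E , ≤-trans
    (join (weight e) 1 c 0 s (weight p * s) t≤
      (≤-trans u≤ (≤-trans (m≤m+n s 0) (m≤m+n _ 0))) 1≤s)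
    (≤-reflexive (cong₂ (λ w d → suc w * s + d * (weight p * s))
                        (+-comm (weight e) 1) (+-identityʳ c)))
⇓-time {p} {s} 1≤s ok (↓self {e} {c = c} {d} D (counted (u , E , u≤)))
  with t , D′ , t≤ ← ⇓-time 1≤s ok D =
  _ , ⇓self D′ E , ≤-trans (join (weight e) 0 c d s _ t≤ u≤ 1≤s)
    (≤-reflexive (cong (λ w → suc w * s + (c + d) * (weight p * s)) (+-identityʳ (weight e))))

-- One activation of p, whose body reaches c further activations.
activate : ∀ {p s u v c b} → size u ≤ s → p at s ∣ u ∷ [] ⊢ p ⇓ v ⟨ c ⟩ → suc c ≤ b →
           p at s on u returns v after b
activate {p} {s} {u} small D c<b
  with t , D′ , t≤ ← ⇓-time (≤-trans (size-≥1 u) small) (small ∷ []) D =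
  counted (t , D′ , ≤-trans t≤ (*-monoˡ-≤ (weight p * s) c<b))

-- Time bounds are functions of polynomials, so that the bound of a caller is
-- built from the bounds of its callees by application.  The product below is
-- opaque because the bounds nest deeply and must not be unfolded.
opaque

  activations : ∀ {k} → Program → Poly k → Poly k → Poly k
  activations p C S = C ⊗ (con (weight p) ⊗ S)

  total : ∀ {k} {a : Vec ℕ k} C S {p u v c} → p at ⟦ S ⟧ᴾ a on u returns v after c →
          c ≤ ⟦ C ⟧ᴾ a → p on u returns v within ⟦ activations p C S ⟧ᴾ a
  total {a = a} C S {p} r c≤ = weaken (*-monoˡ-≤ (weight p * ⟦ S ⟧ᴾ a) c≤) (runs r)

-- P ⊴ Q: P is one of the addends of the sum Q.  The charge s is always a sum
-- of everything it has to bound.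
data _⊴_ {k} (P : Poly k) : Poly k → Set where
  here  : P ⊴ P
  left  : ∀ {Q R} → P ⊴ Q → P ⊴ (Q ⊕ R)
  right : ∀ {Q R} → P ⊴ R → P ⊴ (Q ⊕ R)

⊴-≤ : ∀ {k} {a : Vec ℕ k} {P} Q → P ⊴ Q → ⟦ P ⟧ᴾ a ≤ ⟦ Q ⟧ᴾ a
⊴-≤ Q       here      = ≤-refl
⊴-≤ (Q ⊕ R) (left h)  = m≤n⇒m≤n+o _ (⊴-≤ Q h)
⊴-≤ (Q ⊕ R) (right h) = m≤n⇒m≤o+n _ (⊴-≤ R h)

encBool : Bool → Tree
encBool false = nil
encBool true  = cons nil nil

-- The tree cons nil nil stands for the flag true, the digit 2 and the number 1,
-- which is the tag of a query node.
mark : ∀ {k} → Expr k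
mark = cons nil nil

-- Binary arithmetic

-- Lengths are measured in binary digits (Bin.size), so that doubling adds at
-- most one.  It may nearly double the size of the encoding, as the two digits
-- are encoded by trees of different sizes.

length-suc : ∀ x → Bin.size (Bin.suc x) ≤ suc (Bin.size x)
length-suc zero     = ≤-refl
length-suc 2[1+ x ] = s≤s (length-suc x)
length-suc 1+[2 x ] = n≤1+n _

length-double : ∀ x → Bin.size (Bin.double x) ≤ suc (Bin.size x)
length-double zero     = z≤n
length-double 2[1+ x ] = ≤-refl
length-double 1+[2 x ] = s≤s (length-double x)

length-+ : ∀ x y → Bin.size (x Bin.+ y) ≤ Bin.size x + Bin.size y
length-+ zero     y        = ≤-refl
length-+ 2[1+ x ] zero     = m≤m+n _ 0
length-+ 1+[2 x ] zero     = m≤m+n _ 0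
length-+ 2[1+ x ] 2[1+ y ] = ≤-trans (s≤s (length-suc (x Bin.+ y)))
  (s≤s (≤-trans (s≤s (length-+ x y)) (≤-reflexive (sym (+-suc _ _)))))
length-+ 2[1+ x ] 1+[2 y ] = ≤-trans (s≤s (length-suc (x Bin.+ y)))
  (s≤s (≤-trans (s≤s (length-+ x y)) (≤-reflexive (sym (+-suc _ _)))))
length-+ 1+[2 x ] 2[1+ y ] = ≤-trans (s≤s (length-suc (x Bin.+ y)))
  (s≤s (≤-trans (s≤s (length-+ x y)) (≤-reflexive (sym (+-suc _ _)))))
length-+ 1+[2 x ] 1+[2 y ] = s≤s (≤-trans (m≤n⇒m≤1+n (length-+ x y))
  (≤-reflexive (sym (+-suc _ _))))

size-encᵇ : ∀ x → size (encᵇ x) ≤ 1 + 4 * Bin.size x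
size-encᵇ zero     = ≤-refl
size-encᵇ 2[1+ x ] = ≤-trans (+-monoʳ-≤ 4 (size-encᵇ x))
  (≤-reflexive (cong suc (sym (*-suc 4 (Bin.size x)))))
size-encᵇ 1+[2 x ] = ≤-trans (+-mono-≤ {2} {4} (s≤s (s≤s z≤n)) (size-encᵇ x))
  (≤-reflexive (cong suc (sym (*-suc 4 (Bin.size x)))))

length≤size : ∀ x → Bin.size x ≤ size (encᵇ x)
length≤size zero     = z≤n
length≤size 2[1+ x ] = s≤s (m≤n⇒m≤o+n 3 (length≤size x))
length≤size 1+[2 x ] = s≤s (m≤n⇒m≤1+n (length≤size x))

size-encᵇ-≤ : ∀ x {ℓ} → Bin.size x ≤ ℓ → size (encᵇ x) ≤ 1 + 4 * ℓ
size-encᵇ-≤ x h = ≤-trans (size-encᵇ x) (s≤s (*-monoʳ-≤ 4 h))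

-- The size of the encoding of a number of L digits.
digitsᴾ : ∀ {k} → Poly k → Poly k
digitsᴾ L = con 1 ⊕ con 4 ⊗ L

-- For each program fP below, fS is the charge per node and fT the time bound,
-- as functions of a bound L on the input.
sucP : Program
sucP = case v0 mark
  (case v0
    (cons mark v1)
    (cons nil (self v3)))

sucT : ∀ {k} → Poly k → Poly k
sucT L = activations sucP (con 1 ⊕ L) (digitsᴾ L)

sucP-correct : ∀ {k} {a : Vec ℕ k} L x → Bin.size x ≤ ⟦ L ⟧ᴾ a →
               sucP on encᵇ x returns encᵇ (Bin.suc x) within ⟦ sucT L ⟧ᴾ a
sucP-correct {a = a} L x h =
  total (con 1 ⊕ L) (digitsᴾ L) (go x (size-encᵇ-≤ x h)) (s≤s h)
  where
  s : ℕ
  s = ⟦ digitsᴾ L ⟧ᴾ a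

  go : ∀ x → size (encᵇ x) ≤ s →
       sucP at s on encᵇ x returns encᵇ (Bin.suc x) after suc (Bin.size x)
  go zero     h = activate h (↓case-nil refl (↓cons ↓nil ↓nil)) ≤-refl
  go 1+[2 x ] h = activate h
    (↓case-cons refl (↓case-nil refl (↓cons (↓cons ↓nil ↓nil) (↓var _)))) (s≤s z≤n)
  go 2[1+ x ] h = activate h
    (↓case-cons refl (↓case-cons refl (↓cons ↓nil
      (↓self (↓var _) (go x (≤-trans (m≤n+m (size (encᵇ x)) 4) h))))))
    ≤-refl

doubleP : Program
doubleP = case v0 nil
  (case v0
    (cons mark (self v1))
    (cons mark (cons nil v3)))

doubleT : ∀ {k} → Poly k → Poly k
doubleT L = activations doubleP (con 1 ⊕ L) (digitsᴾ L)

doubleP-correct : ∀ {k} {a : Vec ℕ k} L x → Bin.size x ≤ ⟦ L ⟧ᴾ a →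
                  doubleP on encᵇ x returns encᵇ (Bin.double x) within ⟦ doubleT L ⟧ᴾ a
doubleP-correct {a = a} L x h =
  total (con 1 ⊕ L) (digitsᴾ L) (go x (size-encᵇ-≤ x h)) (s≤s h)
  where
  s : ℕ
  s = ⟦ digitsᴾ L ⟧ᴾ a

  go : ∀ x → size (encᵇ x) ≤ s →
       doubleP at s on encᵇ x returns encᵇ (Bin.double x) after suc (Bin.size x)
  go zero     h = activate h (↓case-nil refl ↓nil) ≤-refl
  go 1+[2 x ] h = activate h
    (↓case-cons refl (↓case-nil refl (↓cons (↓cons ↓nil ↓nil)
      (↓self (↓var _) (go x (≤-trans (m≤n+m (size (encᵇ x)) 2) h))))))
    ≤-refl
  go 2[1+ x ] h = activate h
    (↓case-cons refl (↓case-cons refl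
      (↓cons (↓cons ↓nil ↓nil) (↓cons ↓nil (↓var _))))) (s≤s z≤n)

-- Input cons x y.
addP : Program
addP = case v0 nil
  (case v0
    v1
    (case v3
      v2
      -- The digits of x and y are now v2 and v0, the remainders v3 and v1.
      (let′ (self (cons v3 v1))
        (case v3
          (case v1
            (call sucP (cons nil v0))
            (call sucP (cons mark v2)))
          (case v3
            (call sucP (cons mark v2))
            (cons mark (call sucP v4)))))))

addS addT : ∀ {k} → Poly k → Poly k
addS L = (con 3 ⊕ con 4 ⊗ L) ⊕ sucT (con 1 ⊕ L)
addT L = activations addP (con 1 ⊕ L) (addS L)

size-pair : ∀ x y {ℓ} → Bin.size x + Bin.size y ≤ ℓ →
            size (cons (encᵇ x) (encᵇ y)) ≤ 3 + 4 * ℓ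
size-pair x y {ℓ} h = ≤-trans (s≤s (+-mono-≤ (size-encᵇ x) (size-encᵇ y)))
  (≤-trans (≤-reflexive (eq (Bin.size x) (Bin.size y))) (+-monoʳ-≤ 3 (*-monoʳ-≤ 4 h)))
  where
  eq : ∀ m n → 1 + ((1 + 4 * m) + (1 + 4 * n)) ≡ 3 + 4 * (m + n)
  eq = solve-∀

addP-correct : ∀ {k} {a : Vec ℕ k} L x y → Bin.size x + Bin.size y ≤ ⟦ L ⟧ᴾ a →
               addP on cons (encᵇ x) (encᵇ y) returns encᵇ (x Bin.+ y)
                 within ⟦ addT L ⟧ᴾ a
addP-correct {a = a} L x y h =
  total (con 1 ⊕ L) (addS L) (go x y h) (s≤s (m+n≤o⇒m≤o (Bin.size x) h))
  where
  ℓ s : ℕ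
  ℓ = ⟦ L ⟧ᴾ a
  s = ⟦ addS L ⟧ᴾ a

  input : ∀ x y → Bin.size x + Bin.size y ≤ ℓ → size (cons (encᵇ x) (encᵇ y)) ≤ s
  input x y h = m≤n⇒m≤n+o _ (size-pair x y h)

  step : ∀ z → Bin.size z ≤ suc ℓ → sucP on encᵇ z returns encᵇ (Bin.suc z) within s
  step z h = weaken (⊴-≤ (addS L) (right here)) (sucP-correct (con 1 ⊕ L) z h)

  smaller : ∀ x y → suc (Bin.size x) + suc (Bin.size y) ≤ ℓ → Bin.size x + Bin.size y ≤ ℓ
  smaller x y h = ≤-trans (+-mono-≤ (n≤1+n (Bin.size x)) (n≤1+n (Bin.size y))) h

  short : ∀ x y → suc (Bin.size x) + suc (Bin.size y) ≤ ℓ → Bin.size (x Bin.+ y) ≤ ℓ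
  short x y h = ≤-trans (length-+ x y) (smaller x y h)

  fits : ∀ x y → suc (Bin.size x) + suc (Bin.size y) ≤ ℓ → size (encᵇ (x Bin.+ y)) ≤ s
  fits x y h = m≤n⇒m≤n+o _
    (≤-trans (size-encᵇ-≤ (x Bin.+ y) (short x y h)) (m≤n+m (1 + 4 * ℓ) 2))

  go : ∀ x y → Bin.size x + Bin.size y ≤ ℓ →
       addP at s on cons (encᵇ x) (encᵇ y) returns encᵇ (x Bin.+ y) after suc (Bin.size x)
  go zero y h = activate (input zero y h) (↓case-cons refl (↓case-nil refl (↓var _))) ≤-refl
  go 2[1+ x ] zero h = activate (input 2[1+ x ] zero h)
    (↓case-cons refl (↓case-cons refl (↓case-nil refl (↓var _)))) (s≤s z≤n)
  go 1+[2 x ] zero h = activate (input 1+[2 x ] zero h)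
    (↓case-cons refl (↓case-cons refl (↓case-nil refl (↓var _)))) (s≤s z≤n)
  go 2[1+ x ] 2[1+ y ] h = activate (input 2[1+ x ] 2[1+ y ] h)
    (↓case-cons refl (↓case-cons refl (↓case-cons refl
      (↓let (fits x y h) (↓self (↓cons (↓var _) (↓var _)) (go x y (smaller x y h)))
        (↓case-cons refl (↓case-cons refl (↓cons (↓cons ↓nil ↓nil)
          (↓call (↓var _) (step (x Bin.+ y) (m≤n⇒m≤1+n (short x y h)))))))))))
    (s≤s (≤-reflexive (+-identityʳ _)))
  go 2[1+ x ] 1+[2 y ] h = activate (input 2[1+ x ] 1+[2 y ] h)
    (↓case-cons refl (↓case-cons refl (↓case-cons refl
      (↓let (fits x y h) (↓self (↓cons (↓var _) (↓var _)) (go x y (smaller x y h)))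
        (↓case-cons refl (↓case-nil refl
          (↓call (↓cons (↓cons ↓nil ↓nil) (↓var _)) (step 2[1+ (x Bin.+ y) ] (s≤s (short x y h))))))))))
    (s≤s (≤-reflexive (+-identityʳ _)))
  go 1+[2 x ] 2[1+ y ] h = activate (input 1+[2 x ] 2[1+ y ] h)
    (↓case-cons refl (↓case-cons refl (↓case-cons refl
      (↓let (fits x y h) (↓self (↓cons (↓var _) (↓var _)) (go x y (smaller x y h)))
        (↓case-nil refl (↓case-cons refl
          (↓call (↓cons (↓cons ↓nil ↓nil) (↓var _)) (step 2[1+ (x Bin.+ y) ] (s≤s (short x y h))))))))))
    (s≤s (≤-reflexive (+-identityʳ _)))
  go 1+[2 x ] 1+[2 y ] h = activate (input 1+[2 x ] 1+[2 y ] h)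
    (↓case-cons refl (↓case-cons refl (↓case-cons refl
      (↓let (fits x y h) (↓self (↓cons (↓var _) (↓var _)) (go x y (smaller x y h)))
        (↓case-nil refl (↓case-nil refl
          (↓call (↓cons ↓nil (↓var _)) (step 1+[2 (x Bin.+ y) ] (s≤s (short x y h))))))))))
    (s≤s (≤-reflexive (+-identityʳ _)))

-- Multiplication by recursion on the first factor alone; unlike Bin._*_ it needs
-- only addition and doubling at each digit.
mulᵇ : ℕᵇ → ℕᵇ → ℕᵇ
mulᵇ zero     y = zero
mulᵇ 2[1+ x ] y = Bin.double (y Bin.+ mulᵇ x y)
mulᵇ 1+[2 x ] y = y Bin.+ Bin.double (mulᵇ x y)

toℕ-mulᵇ : ∀ x y → Bin.toℕ (mulᵇ x y) ≡ Bin.toℕ x * Bin.toℕ y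
toℕ-mulᵇ zero     y = refl
toℕ-mulᵇ 2[1+ x ] y rewrite Binₚ.toℕ-double (y Bin.+ mulᵇ x y)
                          | Binₚ.toℕ-homo-+ y (mulᵇ x y) | toℕ-mulᵇ x y =
  sym (*-assoc 2 (suc (Bin.toℕ x)) (Bin.toℕ y))
toℕ-mulᵇ 1+[2 x ] y rewrite Binₚ.toℕ-homo-+ y (Bin.double (mulᵇ x y))
                          | Binₚ.toℕ-double (mulᵇ x y) | toℕ-mulᵇ x y =
  cong (Bin.toℕ y +_) (sym (*-assoc 2 (Bin.toℕ x) (Bin.toℕ y)))

length-mulᵇ : ∀ x y → Bin.size (mulᵇ x y) ≤ Bin.size x * suc (Bin.size y)
length-mulᵇ zero     y = z≤n
length-mulᵇ 2[1+ x ] y = ≤-trans (length-double (y Bin.+ mulᵇ x y))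
  (s≤s (≤-trans (length-+ y (mulᵇ x y)) (+-monoʳ-≤ (Bin.size y) (length-mulᵇ x y))))
length-mulᵇ 1+[2 x ] y = ≤-trans (length-+ y (Bin.double (mulᵇ x y)))
  (≤-trans (+-monoʳ-≤ (Bin.size y) (≤-trans (length-double (mulᵇ x y)) (s≤s (length-mulᵇ x y))))
           (≤-reflexive (+-suc _ _)))

-- Input cons x y.
mulP : Program
mulP = case v0 nil
  (case v0 nil
    (let′ (self (cons v1 v3))
      (case v1
        (call addP (cons v4 (call doubleP v0)))
        (call doubleP (call addP (cons v6 v2))))))

-- mulL bounds the number of digits of a product.
mulL mulS mulT : ∀ {k} → Poly k → Poly k
mulL L = L ⊗ (con 1 ⊕ L)
mulS L = (con 3 ⊕ con 4 ⊗ (L ⊕ L)) ⊕ digitsᴾ (mulL L) ⊕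
         addT (L ⊕ (con 1 ⊕ mulL L)) ⊕ doubleT (L ⊕ mulL L)
mulT L = activations mulP (con 1 ⊕ L) (mulS L)

mulP-correct : ∀ {k} {a : Vec ℕ k} L x y → Bin.size x ≤ ⟦ L ⟧ᴾ a → Bin.size y ≤ ⟦ L ⟧ᴾ a →
               mulP on cons (encᵇ x) (encᵇ y) returns encᵇ (mulᵇ x y) within ⟦ mulT L ⟧ᴾ a
mulP-correct {a = a} L x y hx hy =
  total (con 1 ⊕ L) (mulS L) (go x hx) (s≤s hx)
  where
  ℓ m s : ℕ
  ℓ = ⟦ L ⟧ᴾ a
  m = ⟦ mulL L ⟧ᴾ a
  s = ⟦ mulS L ⟧ᴾ a

  short : ∀ x → Bin.size x ≤ ℓ → Bin.size (mulᵇ x y) ≤ m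
  short x h = ≤-trans (length-mulᵇ x y) (*-mono-≤ h (s≤s hy))

  fits : ∀ x → Bin.size x ≤ ℓ → size (encᵇ (mulᵇ x y)) ≤ s
  fits x h = m≤n⇒m≤n+o _ (m≤n⇒m≤n+o _ (m≤n⇒m≤o+n (3 + 4 * (ℓ + ℓ))
    (size-encᵇ-≤ (mulᵇ x y) (short x h))))

  input : ∀ x → Bin.size x ≤ ℓ → size (cons (encᵇ x) (encᵇ y)) ≤ s
  input x h = m≤n⇒m≤n+o _ (m≤n⇒m≤n+o _ (m≤n⇒m≤n+o _ (size-pair x y (+-mono-≤ h hy))))

  add : ∀ z → Bin.size z ≤ suc m →
        addP on cons (encᵇ y) (encᵇ z) returns encᵇ (y Bin.+ z) within s
  add z h = weaken (⊴-≤ (mulS L) (left (right here)))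
    (addP-correct (L ⊕ (con 1 ⊕ mulL L)) y z (+-mono-≤ hy h))

  dbl : ∀ z → Bin.size z ≤ ℓ + m →
        doubleP on encᵇ z returns encᵇ (Bin.double z) within s
  dbl z h = weaken (⊴-≤ (mulS L) (right here)) (doubleP-correct (L ⊕ mulL L) z h)

  go : ∀ x → Bin.size x ≤ ℓ →
       mulP at s on cons (encᵇ x) (encᵇ y) returns encᵇ (mulᵇ x y) after suc (Bin.size x)
  go zero h = activate (input zero h) (↓case-cons refl (↓case-nil refl ↓nil)) ≤-refl
  go 1+[2 x ] h = activate (input 1+[2 x ] h)
    (↓case-cons refl (↓case-cons refl
      (↓let (fits x h′) (↓self (↓cons (↓var _) (↓var _)) (go x h′))
        (↓case-nil refl
          (↓call (↓cons (↓var _) (↓call (↓var _) (dbl (mulᵇ x y) (m≤n⇒m≤o+n ℓ (short x h′)))))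
            (add (Bin.double (mulᵇ x y))
              (≤-trans (length-double (mulᵇ x y)) (s≤s (short x h′)))))))))
    (s≤s (≤-reflexive (+-identityʳ _)))
    where
    h′ : Bin.size x ≤ ℓ
    h′ = ≤-trans (n≤1+n _) h
  go 2[1+ x ] h = activate (input 2[1+ x ] h)
    (↓case-cons refl (↓case-cons refl
      (↓let (fits x h′) (↓self (↓cons (↓var _) (↓var _)) (go x h′))
        (↓case-cons refl
          (↓call (↓call (↓cons (↓var _) (↓var _)) (add (mulᵇ x y) (m≤n⇒m≤1+n (short x h′))))
            (dbl (y Bin.+ mulᵇ x y)
              (≤-trans (length-+ y (mulᵇ x y)) (+-mono-≤ hy (short x h′)))))))))
    (s≤s (≤-reflexive (+-identityʳ _)))
    where
    h′ : Bin.size x ≤ ℓ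
    h′ = ≤-trans (n≤1+n _) h

-- compareᵇ b x y decides x ≤ y if b is true and x < y if b is false.  The
-- least significant digits come first, so the flag b records the comparison
-- of the digits already read.
compareᵇ : Bool → ℕᵇ → ℕᵇ → Bool
compareᵇ b zero     zero     = b
compareᵇ b zero     2[1+ y ] = true
compareᵇ b zero     1+[2 y ] = true
compareᵇ b 2[1+ x ] zero     = false
compareᵇ b 1+[2 x ] zero     = false
compareᵇ b 2[1+ x ] 2[1+ y ] = compareᵇ b x y
compareᵇ b 2[1+ x ] 1+[2 y ] = compareᵇ false x y
compareᵇ b 1+[2 x ] 2[1+ y ] = compareᵇ true x y
compareᵇ b 1+[2 x ] 1+[2 y ] = compareᵇ b x y

bit : Bool → ℕ
bit false = 0
bit true  = 1

2*suc : ∀ m → 2 * suc m ≡ 2 + 2 * m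
2*suc = *-suc 2

compareᵇ-true : ∀ b x y → compareᵇ b x y ≡ true → Bin.toℕ x < bit b + Bin.toℕ y
compareᵇ-true true  zero     zero     _ = s≤s z≤n
compareᵇ-true b     zero     2[1+ y ] _ = ≤-trans (s≤s z≤n) (m≤n+m _ (bit b))
compareᵇ-true b     zero     1+[2 y ] _ = ≤-trans (s≤s z≤n) (m≤n+m _ (bit b))
compareᵇ-true false 2[1+ x ] 2[1+ y ] e = *-monoʳ-< 2 (s≤s (compareᵇ-true false x y e))
compareᵇ-true true  2[1+ x ] 2[1+ y ] e = s≤s (*-monoʳ-≤ 2 (compareᵇ-true true x y e))
compareᵇ-true b     2[1+ x ] 1+[2 y ] e =
  ≤-trans (s≤s (*-monoʳ-≤ 2 (compareᵇ-true false x y e))) (m≤n+m _ (bit b))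
compareᵇ-true b     1+[2 x ] 2[1+ y ] e =
  ≤-trans (≤-reflexive (sym (2*suc (Bin.toℕ x))))
    (≤-trans (*-monoʳ-≤ 2 (compareᵇ-true true x y e)) (m≤n+m _ (bit b)))
compareᵇ-true false 1+[2 x ] 1+[2 y ] e = s≤s (*-monoʳ-< 2 (compareᵇ-true false x y e))
compareᵇ-true true  1+[2 x ] 1+[2 y ] e with s≤s x≤y ← compareᵇ-true true x y e =
  s≤s (s≤s (*-monoʳ-≤ 2 x≤y))

compareᵇ-false : ∀ b x y → compareᵇ b x y ≡ false → bit b + Bin.toℕ y ≤ Bin.toℕ x
compareᵇ-false false zero     zero     _ = z≤n
compareᵇ-false false 2[1+ x ] zero     _ = z≤n
compareᵇ-false true  2[1+ x ] zero     _ = s≤s z≤n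
compareᵇ-false false 1+[2 x ] zero     _ = z≤n
compareᵇ-false true  1+[2 x ] zero     _ = s≤s z≤n
compareᵇ-false false 2[1+ x ] 2[1+ y ] e = *-monoʳ-≤ 2 (s≤s (compareᵇ-false false x y e))
compareᵇ-false true  2[1+ x ] 2[1+ y ] e = *-monoʳ-< 2 (s≤s (compareᵇ-false true x y e))
compareᵇ-false false 2[1+ x ] 1+[2 y ] e =
  ≤-trans (n≤1+n _) (≤-trans (≤-reflexive (sym (2*suc (Bin.toℕ y))))
    (*-monoʳ-≤ 2 (s≤s (compareᵇ-false false x y e))))
compareᵇ-false true  2[1+ x ] 1+[2 y ] e =
  ≤-trans (≤-reflexive (sym (2*suc (Bin.toℕ y))))
    (*-monoʳ-≤ 2 (s≤s (compareᵇ-false false x y e)))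
compareᵇ-false false 1+[2 x ] 2[1+ y ] e =
  m≤n⇒m≤1+n (*-monoʳ-≤ 2 (compareᵇ-false true x y e))
compareᵇ-false true  1+[2 x ] 2[1+ y ] e = s≤s (*-monoʳ-≤ 2 (compareᵇ-false true x y e))
compareᵇ-false false 1+[2 x ] 1+[2 y ] e = s≤s (*-monoʳ-≤ 2 (compareᵇ-false false x y e))
compareᵇ-false true  1+[2 x ] 1+[2 y ] e =
  m≤n⇒m≤1+n (≤-trans (≤-reflexive (sym (2*suc (Bin.toℕ y))))
                     (*-monoʳ-≤ 2 (compareᵇ-false true x y e)))

-- Input cons b (cons x y).
compareP : Program
compareP = case v0 nil
  (case v1 nil
    (case v0
      (case v1 v2 mark)
      (case v3 nil
        (case v2
          (case v0
            (self (cons v6 (cons v3 v1)))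
            (self (cons mark (cons v5 v3))))
          (case v2
            (self (cons nil (cons v5 v3)))
            (self (cons v10 (cons v7 v5))))))))

compareS compareT : ∀ {k} → Poly k → Poly k
compareS L = con 7 ⊕ con 4 ⊗ (L ⊕ L)
compareT L = activations compareP (con 1 ⊕ L) (compareS L)

compareP-correct : ∀ {k} {a : Vec ℕ k} L b x y →
                   Bin.size x ≤ ⟦ L ⟧ᴾ a → Bin.size y ≤ ⟦ L ⟧ᴾ a →
                   compareP on cons (encBool b) (cons (encᵇ x) (encᵇ y))
                     returns encBool (compareᵇ b x y) within ⟦ compareT L ⟧ᴾ a
compareP-correct {a = a} L b x y hx hy =
  total (con 1 ⊕ L) (compareS L) (go b x y hx hy) (s≤s hx)
  where
  ℓ s : ℕ
  ℓ = ⟦ L ⟧ᴾ a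
  s = ⟦ compareS L ⟧ᴾ a

  size-flag : ∀ b → size (encBool b) ≤ 3
  size-flag false = s≤s z≤n
  size-flag true  = ≤-refl

  input : ∀ b x y → Bin.size x ≤ ℓ → Bin.size y ≤ ℓ →
          size (cons (encBool b) (cons (encᵇ x) (encᵇ y))) ≤ s
  input b x y hx hy = s≤s (+-mono-≤ (size-flag b) (size-pair x y (+-mono-≤ hx hy)))

  go : ∀ b x y → Bin.size x ≤ ℓ → Bin.size y ≤ ℓ →
       compareP at s on cons (encBool b) (cons (encᵇ x) (encᵇ y))
         returns encBool (compareᵇ b x y) after suc (Bin.size x)
  go b zero zero hx hy = activate (input b zero zero hx hy)
    (↓case-cons refl (↓case-cons refl (↓case-nil refl (↓case-nil refl (↓var _))))) ≤-refl
  go b zero 2[1+ y ] hx hy = activate (input b zero 2[1+ y ] hx hy)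
    (↓case-cons refl (↓case-cons refl (↓case-nil refl
      (↓case-cons refl (↓cons ↓nil ↓nil))))) ≤-refl
  go b zero 1+[2 y ] hx hy = activate (input b zero 1+[2 y ] hx hy)
    (↓case-cons refl (↓case-cons refl (↓case-nil refl
      (↓case-cons refl (↓cons ↓nil ↓nil))))) ≤-refl
  go b 2[1+ x ] zero hx hy = activate (input b 2[1+ x ] zero hx hy)
    (↓case-cons refl (↓case-cons refl (↓case-cons refl (↓case-nil refl ↓nil)))) (s≤s z≤n)
  go b 1+[2 x ] zero hx hy = activate (input b 1+[2 x ] zero hx hy)
    (↓case-cons refl (↓case-cons refl (↓case-cons refl (↓case-nil refl ↓nil)))) (s≤s z≤n)
  go b 2[1+ x ] 2[1+ y ] hx hy = activate (input b 2[1+ x ] 2[1+ y ] hx hy)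
    (↓case-cons refl (↓case-cons refl (↓case-cons refl (↓case-cons refl
      (↓case-cons refl (↓case-cons refl
        (↓self (↓cons (↓var _) (↓cons (↓var _) (↓var _)))
          (go b x y (<⇒≤ hx) (<⇒≤ hy)))))))))
    ≤-refl
  go b 2[1+ x ] 1+[2 y ] hx hy = activate (input b 2[1+ x ] 1+[2 y ] hx hy)
    (↓case-cons refl (↓case-cons refl (↓case-cons refl (↓case-cons refl
      (↓case-cons refl (↓case-nil refl
        (↓self (↓cons ↓nil (↓cons (↓var _) (↓var _)))
          (go false x y (<⇒≤ hx) (<⇒≤ hy)))))))))
    ≤-refl
  go b 1+[2 x ] 2[1+ y ] hx hy = activate (input b 1+[2 x ] 2[1+ y ] hx hy)
    (↓case-cons refl (↓case-cons refl (↓case-cons refl (↓case-cons refl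
      (↓case-nil refl (↓case-cons refl
        (↓self (↓cons (↓cons ↓nil ↓nil) (↓cons (↓var _) (↓var _)))
          (go true x y (<⇒≤ hx) (<⇒≤ hy)))))))))
    ≤-refl
  go b 1+[2 x ] 1+[2 y ] hx hy = activate (input b 1+[2 x ] 1+[2 y ] hx hy)
    (↓case-cons refl (↓case-cons refl (↓case-cons refl (↓case-cons refl
      (↓case-nil refl (↓case-nil refl
        (↓self (↓cons (↓var _) (↓cons (↓var _) (↓var _)))
          (go b x y (<⇒≤ hx) (<⇒≤ hy)))))))))
    ≤-refl

length-encℕ : ∀ k → Bin.size (Bin.fromℕ k) ≤ size (encℕ k)
length-encℕ k = length≤size (Bin.fromℕ k)

-- Equality as two comparisons, on input cons x y.
equalP : Program
equalP = case v0 nil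
  (let′ (call compareP (cons mark (cons v0 v1)))
    (case v0 nil
      (call compareP (cons mark (cons v4 v3)))))

equalS equalT : ∀ {k} → Poly k → Poly k
equalS L = (con 3 ⊕ con 4 ⊗ (L ⊕ L)) ⊕ compareT L
equalT L = activations equalP (con 1) (equalS L)

equalP-correct : ∀ {k} {a : Vec ℕ k} L {n} (i j : Fin n) →
                 size (encℕ (toℕ i)) ≤ ⟦ L ⟧ᴾ a → size (encℕ (toℕ j)) ≤ ⟦ L ⟧ᴾ a →
                 equalP on cons (encℕ (toℕ i)) (encℕ (toℕ j))
                   returns encBool (does (i Finₚ.≟ j)) within ⟦ equalT L ⟧ᴾ a
equalP-correct {a = a} L i j hi hj = total (con 1) (equalS L) go ≤-refl
  where
  x y : ℕᵇ
  x = Bin.fromℕ (toℕ i)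
  y = Bin.fromℕ (toℕ j)

  ℓ s : ℕ
  ℓ = ⟦ L ⟧ᴾ a
  s = ⟦ equalS L ⟧ᴾ a

  hx : Bin.size x ≤ ℓ
  hx = ≤-trans (length-encℕ (toℕ i)) hi

  hy : Bin.size y ≤ ℓ
  hy = ≤-trans (length-encℕ (toℕ j)) hj

  input : size (cons (encᵇ x) (encᵇ y)) ≤ s
  input = m≤n⇒m≤n+o _ (size-pair x y (+-mono-≤ hx hy))

  test : ∀ x y → Bin.size x ≤ ℓ → Bin.size y ≤ ℓ →
         compareP on cons (encBool true) (cons (encᵇ x) (encᵇ y))
           returns encBool (compareᵇ true x y) within s
  test x y hx hy = weaken (⊴-≤ (equalS L) (right here)) (compareP-correct L true x y hx hy)

  ≤-true : ∀ {m n} → compareᵇ true (Bin.fromℕ m) (Bin.fromℕ n) ≡ true → m ≤ n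
  ≤-true {m} {n} e = ≤-pred (subst₂ (λ k l → k < suc l) (Binₚ.toℕ-fromℕ m) (Binₚ.toℕ-fromℕ n)
    (compareᵇ-true true (Bin.fromℕ m) (Bin.fromℕ n) e))

  <-false : ∀ {m n} → compareᵇ true (Bin.fromℕ m) (Bin.fromℕ n) ≡ false → n < m
  <-false {m} {n} e = subst₂ (λ k l → suc l ≤ k) (Binₚ.toℕ-fromℕ m) (Binₚ.toℕ-fromℕ n)
    (compareᵇ-false true (Bin.fromℕ m) (Bin.fromℕ n) e)

  go : equalP at s on cons (encᵇ x) (encᵇ y) returns encBool (does (i Finₚ.≟ j)) after 1
  go with compareᵇ true x y in e | test x y hx hy
  go | false | r rewrite dec-false (i Finₚ.≟ j) (λ i≡j → <⇒≢ (<-false e) (cong toℕ (sym i≡j))) =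
    activate input (↓case-cons refl
      (↓let (output-size r) (↓call (↓cons (↓cons ↓nil ↓nil) (↓cons (↓var _) (↓var _))) r)
        (↓case-nil refl ↓nil))) ≤-refl
  go | true  | r with compareᵇ true y x in e′ | test y x hy hx
  ... | false | r′ rewrite dec-false (i Finₚ.≟ j) (λ i≡j → <⇒≢ (<-false e′) (cong toℕ i≡j)) =
    activate input (↓case-cons refl
      (↓let (output-size r) (↓call (↓cons (↓cons ↓nil ↓nil) (↓cons (↓var _) (↓var _))) r)
        (↓case-cons refl (↓call (↓cons (↓cons ↓nil ↓nil) (↓cons (↓var _) (↓var _))) r′)))) ≤-refl
  ... | true  | r′ rewrite dec-true (i Finₚ.≟ j)
                             (Finₚ.toℕ-injective (≤-antisym (≤-true e) (≤-true e′))) =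
    activate input (↓case-cons refl
      (↓let (output-size r) (↓call (↓cons (↓cons ↓nil ↓nil) (↓cons (↓var _) (↓var _))) r)
        (↓case-cons refl (↓call (↓cons (↓cons ↓nil ↓nil) (↓cons (↓var _) (↓var _))) r′)))) ≤-refl

-- Comparison of nonnegative rationals by cross multiplication: the signs are
-- skipped, and once they are taken apart the inputs are v5 / v7 and v1 / v3.
leqP : Program
leqP = case v0 nil (case v0 nil (case v0 nil (case v5 nil (case v0 nil
  (call compareP (cons mark (cons (call mulP (cons v5 v3)) (call mulP (cons v1 v7)))))))))

leqS leqT : ∀ {k} → Poly k → Poly k
leqS L = (con 1 ⊕ (L ⊕ L)) ⊕ mulT L ⊕ compareT (mulL L)
leqT L = activations leqP (con 1) (leqS L)

leqP-correct : ∀ {k} {a : Vec ℕ k} L (p q : ℚ) → 0ℚ ℚ.≤ p → 0ℚ ℚ.≤ q →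
               size (encℚ p) ≤ ⟦ L ⟧ᴾ a → size (encℚ q) ≤ ⟦ L ⟧ᴾ a →
               leqP on cons (encℚ p) (encℚ q) returns encBool (does (p ℚₚ.≤? q))
                 within ⟦ leqT L ⟧ᴾ a
leqP-correct L (mkℚ ℤ.-[1+ _ ] _ _) q (ℚ.*≤* ()) _ _ _
leqP-correct L p@(mkℚ (ℤ.+ _) _ _) (mkℚ ℤ.-[1+ _ ] _ _) _ (ℚ.*≤* ()) _ _
leqP-correct {a = a} L p@(mkℚ (ℤ.+ c) d-1 _) q@(mkℚ (ℤ.+ e) f-1 _) _ _ hp hq =
  total (con 1) (leqS L)
  (activate input
    (↓case-cons refl (↓case-cons refl (↓case-cons refl (↓case-cons refl (↓case-cons refl
      (↓call (↓cons (↓cons ↓nil ↓nil)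
                (↓cons (↓call (↓cons (↓var _) (↓var _)) (mul c f numer-p denom-q))
                       (↓call (↓cons (↓var _) (↓var _)) (mul e d numer-q denom-p))))
        test))))))
    ≤-refl)
  ≤-refl
  where
  d f ℓ s : ℕ
  d = suc d-1
  f = suc f-1
  ℓ = ⟦ L ⟧ᴾ a
  s = ⟦ leqS L ⟧ᴾ a

  input : size (cons (encℚ p) (encℚ q)) ≤ s
  input = m≤n⇒m≤n+o _ (m≤n⇒m≤n+o _ (s≤s (+-mono-≤ hp hq)))

  numer : ∀ {c d ℓ} → size (cons (cons nil (encℕ c)) (encℕ d)) ≤ ℓ → Bin.size (Bin.fromℕ c) ≤ ℓ
  numer {c} h = ≤-trans (length-encℕ c)
    (≤-trans (m≤n⇒m≤1+n (m≤n⇒m≤n+o _ (m≤n⇒m≤o+n 2 ≤-refl))) h)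

  denom : ∀ {c d ℓ} → size (cons (cons nil (encℕ c)) (encℕ d)) ≤ ℓ → Bin.size (Bin.fromℕ d) ≤ ℓ
  denom {c} {d} h = ≤-trans (length-encℕ d)
    (≤-trans (m≤n⇒m≤1+n (m≤n+m _ (2 + size (encℕ c)))) h)

  numer-p : Bin.size (Bin.fromℕ c) ≤ ℓ
  numer-p = numer {c} {d} hp
  denom-p : Bin.size (Bin.fromℕ d) ≤ ℓ
  denom-p = denom {c} {d} hp
  numer-q : Bin.size (Bin.fromℕ e) ≤ ℓ
  numer-q = numer {e} {f} hq
  denom-q : Bin.size (Bin.fromℕ f) ≤ ℓ
  denom-q = denom {e} {f} hq

  product : ℕ → ℕ → ℕᵇ
  product i j = mulᵇ (Bin.fromℕ i) (Bin.fromℕ j)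

  mul : ∀ i j → Bin.size (Bin.fromℕ i) ≤ ℓ → Bin.size (Bin.fromℕ j) ≤ ℓ →
        mulP on cons (encℕ i) (encℕ j) returns encᵇ (product i j) within s
  mul i j hi hj = weaken (⊴-≤ (leqS L) (left (right here)))
    (mulP-correct L (Bin.fromℕ i) (Bin.fromℕ j) hi hj)

  short : ∀ i j → Bin.size (Bin.fromℕ i) ≤ ℓ → Bin.size (Bin.fromℕ j) ≤ ℓ →
          Bin.size (product i j) ≤ ⟦ mulL L ⟧ᴾ a
  short i j hi hj =
    ≤-trans (length-mulᵇ (Bin.fromℕ i) (Bin.fromℕ j)) (*-mono-≤ hi (s≤s hj))

  toℕ-product : ∀ i j → Bin.toℕ (product i j) ≡ i * j
  toℕ-product i j = trans (toℕ-mulᵇ (Bin.fromℕ i) (Bin.fromℕ j))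
    (cong₂ _*_ (Binₚ.toℕ-fromℕ i) (Binₚ.toℕ-fromℕ j))

  decides : compareᵇ true (product c f) (product e d) ≡ does (p ℚₚ.≤? q)
  decides with compareᵇ true (product c f) (product e d) in eq
  ... | true  = sym (dec-true (p ℚₚ.≤? q) (ℚ.*≤* (subst₂ ℤ._≤_ (ℤₚ.pos-* c f) (ℤₚ.pos-* e d)
    (ℤ.+≤+ (subst₂ _≤_ (toℕ-product c f) (toℕ-product e d)
      (≤-pred (compareᵇ-true true (product c f) (product e d) eq)))))))
  ... | false = sym (dec-false (p ℚₚ.≤? q) (λ p≤q → ℚₚ.<-irrefl refl (ℚₚ.<-≤-trans q<p p≤q)))
    where
    q<p : q ℚ.< p
    q<p = ℚ.*<* (subst₂ ℤ._<_ (ℤₚ.pos-* e d) (ℤₚ.pos-* c f)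
      (ℤ.+<+ (subst₂ _<_ (toℕ-product e d) (toℕ-product c f)
        (compareᵇ-false true (product c f) (product e d) eq))))

  test : compareP on cons (encBool true) (cons (encᵇ (product c f)) (encᵇ (product e d)))
           returns encBool (does (p ℚₚ.≤? q)) within s
  test = weaken (⊴-≤ (leqS L) (right here)) (subst
    (λ b → compareP on cons (encBool true) (cons (encᵇ (product c f)) (encᵇ (product e d)))
             returns encBool b within ⟦ compareT (mulL L) ⟧ᴾ a)
    decides
    (compareP-correct (mulL L) true (product c f) (product e d)
      (short c f numer-p denom-q) (short e d numer-q denom-p)))

-- Enumerating the variables

encVars : ∀ {n} → List (Fin n) → Tree
encVars []       = nil
encVars (i ∷ is) = cons (encℕ (toℕ i)) (encVars is)

-- The variables with index less than k, in decreasing order.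
below : ∀ {n} k → k ≤ n → List (Fin n)
below zero    _ = []
below (suc k) h = fromℕ< h ∷ below k (<⇒≤ h)

allVars : ∀ n → List (Fin n)
allVars n = below n ≤-refl

length-below : ∀ {n} k (h : k ≤ n) → length (below k h) ≡ k
length-below zero    h = refl
length-below (suc k) h = cong suc (length-below k (<⇒≤ h))

∈-below : ∀ {n} k (h : k ≤ n) i → toℕ i < k → i ∈ below k h
∈-below (suc k) h i i<k with m≤n⇒m<n∨m≡n (≤-pred i<k)
... | inj₁ i<k′ = Any.there (∈-below k (<⇒≤ h) i i<k′)
... | inj₂ i≡k  = Any.here (Finₚ.toℕ-injective (trans i≡k (sym (Finₚ.toℕ-fromℕ< h))))

∈-allVars : ∀ {n} (i : Fin n) → i ∈ allVars n
∈-allVars {n} i = ∈-below n ≤-refl i (Finₚ.toℕ<n i)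

length≤toℕ : ∀ x → Bin.size x ≤ Bin.toℕ x
length≤toℕ zero     = z≤n
length≤toℕ 2[1+ x ] = ≤-trans (s≤s (length≤toℕ x)) (m≤m+n _ _)
length≤toℕ 1+[2 x ] = s≤s (≤-trans (length≤toℕ x) (m≤m+n _ _))

size-encℕ : ∀ k → size (encℕ k) ≤ 1 + 4 * k
size-encℕ k = size-encᵇ-≤ (Bin.fromℕ k)
  (≤-trans (length≤toℕ (Bin.fromℕ k)) (≤-reflexive (Binₚ.toℕ-fromℕ k)))

-- Counts down from the encoding of n; the two branches compute the
-- predecessor according to the last digit.
varsP : Program
varsP = case v0 nil
  (case v0
    (let′ (call doubleP v1) (cons v0 (self v0)))
    (let′ (cons nil v3) (cons v0 (self v0))))

varsS varsT : ∀ {k} → Poly k → Poly k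
varsS L = digitsᴾ L ⊕ doubleT L
varsT L = activations varsP (con 1 ⊕ L) (varsS L)

varsP-correct : ∀ {k} {a : Vec ℕ k} L n → n ≤ ⟦ L ⟧ᴾ a →
                varsP on encℕ n returns encVars (allVars n) within ⟦ varsT L ⟧ᴾ a
varsP-correct {a = a} L n n≤ℓ =
  total (con 1 ⊕ L) (varsS L) (go n ≤-refl (Bin.fromℕ n) (Binₚ.toℕ-fromℕ n)) (s≤s n≤ℓ)
  where
  ℓ s : ℕ
  ℓ = ⟦ L ⟧ᴾ a
  s = ⟦ varsS L ⟧ᴾ a

  length-≤ : ∀ {k} → k ≤ n → ∀ x → Bin.toℕ x ≡ k → Bin.size x ≤ ℓ
  length-≤ h x refl = ≤-trans (length≤toℕ x) (≤-trans h n≤ℓ)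

  fits : ∀ {k} → k ≤ n → ∀ x → Bin.toℕ x ≡ k → size (encᵇ x) ≤ s
  fits h x e = m≤n⇒m≤n+o _ (size-encᵇ-≤ x (length-≤ h x e))

  encode : ∀ {k} (h : k < n) x → Bin.toℕ x ≡ k → encᵇ x ≡ encℕ (toℕ (fromℕ< h))
  encode h x refl =
    cong encᵇ (trans (sym (Binₚ.fromℕ-toℕ x)) (cong Bin.fromℕ (sym (Finₚ.toℕ-fromℕ< h))))

  go : ∀ k (h : k ≤ n) x → Bin.toℕ x ≡ k →
       varsP at s on encᵇ x returns encVars (below k h) after suc k
  go zero h zero e = activate (fits h zero e) (↓case-nil refl ↓nil) ≤-refl
  go (suc k) h 1+[2 x ] e =
    subst (λ u → varsP at s on encᵇ 1+[2 x ] returns cons u (encVars (below k (<⇒≤ h))) after suc (suc k))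
      (encode h (Bin.double x) e′)
      (activate (fits h 1+[2 x ] e)
        (↓case-cons refl (↓case-nil refl
          (↓let (output-size double) (↓call (↓var _) double)
            (↓cons (↓var _) (↓self (↓var _) (go k (<⇒≤ h) (Bin.double x) e′))))))
        ≤-refl)
    where
    e′ : Bin.toℕ (Bin.double x) ≡ k
    e′ = trans (Binₚ.toℕ-double x) (suc-injective e)

    double : doubleP on encᵇ x returns encᵇ (Bin.double x) within s
    double = weaken (⊴-≤ (varsS L) (right here)) (doubleP-correct L x (<⇒≤ (length-≤ h 1+[2 x ] e)))
  go (suc k) h 2[1+ x ] e =
    subst (λ u → varsP at s on encᵇ 2[1+ x ] returns cons u (encVars (below k (<⇒≤ h))) after suc (suc k))
      (encode h 1+[2 x ] e′)
      (activate (fits h 2[1+ x ] e)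
        (↓case-cons refl (↓case-cons refl
          (↓let (fits (<⇒≤ h) 1+[2 x ] e′) (↓cons ↓nil (↓var _))
            (↓cons (↓var _) (↓self (↓var _) (go k (<⇒≤ h) 1+[2 x ] e′))))))
        ≤-refl)
    where
    e′ : suc (2 * Bin.toℕ x) ≡ k
    e′ = suc-injective (trans (sym (2*suc (Bin.toℕ x))) e)

size-encVars-below : ∀ {n} k (h : k ≤ n) → size (encVars (below k h)) ≤ 1 + k * (2 + 4 * n)
size-encVars-below zero    h = ≤-refl
size-encVars-below {n} (suc k) h = s≤s (≤-trans
  (+-mono-≤ (≤-trans (size-encℕ (toℕ (fromℕ< h))) (s≤s (*-monoʳ-≤ 4 (<⇒≤ (Finₚ.toℕ<n (fromℕ< h))))))
            (size-encVars-below k (<⇒≤ h)))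
  (≤-reflexive (+-suc (1 + 4 * n) _)))

-- Restrictions and means

-- The tree under the assumption that variable i has value b.
restrict : ∀ {n} → Fin n → Bool → RDT n → RDT n
restrict i b (leaf v)        = leaf v
restrict i b (query j T₀ T₁) =
  if does (i Finₚ.≟ j)
  then (if b then restrict i b T₁ else restrict i b T₀)
  else query j (restrict i b T₀) (restrict i b T₁)
restrict i b (coin T₀ T₁)    = coin (restrict i b T₀) (restrict i b T₁)

queries-restrict : ∀ {n} (i : Fin n) b T → queries (restrict i b T) ≤ queries T
queries-restrict i b (leaf v)     = z≤n
queries-restrict i b (coin T₀ T₁) = ⊔-mono-≤ (queries-restrict i b T₀) (queries-restrict i b T₁)
queries-restrict i b (query j T₀ T₁) with i Finₚ.≟ j | b
... | no  _ | _     = s≤s (⊔-mono-≤ (queries-restrict i _ T₀) (queries-restrict i _ T₁))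
... | yes _ | false = m≤n⇒m≤1+n (m≤n⇒m≤n⊔o _ (queries-restrict i false T₀))
... | yes _ | true  = m≤n⇒m≤1+n (m≤n⇒m≤o⊔n _ (queries-restrict i true T₁))

size-restrict : ∀ {n} (i : Fin n) b T → size (encRDT (restrict i b T)) ≤ size (encRDT T)
size-restrict i b (leaf v)     = ≤-refl
size-restrict i b (coin T₀ T₁) =
  +-monoʳ-≤ 7 (+-mono-≤ (size-restrict i b T₀) (size-restrict i b T₁))
size-restrict i b (query j T₀ T₁) with i Finₚ.≟ j | b
... | no  _ | _     = s≤s (+-monoʳ-≤ 3 (s≤s (+-monoʳ-≤ (size (encℕ (toℕ j)))
      (s≤s (+-mono-≤ (size-restrict i _ T₀) (size-restrict i _ T₁))))))
... | yes _ | false = ≤-trans (size-restrict i false T₀)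
      (m≤n⇒m≤o+n 5 (m≤n⇒m≤o+n (size (encℕ (toℕ j))) (m≤n⇒m≤1+n (m≤m+n _ _))))
... | yes _ | true  = ≤-trans (size-restrict i true T₁)
      (m≤n⇒m≤o+n 5 (m≤n⇒m≤o+n (size (encℕ (toℕ j))) (m≤n⇒m≤1+n (m≤n+m _ (size (encRDT T₀))))))

-- The mean function by recursion on the tree, free of the number of random bits.
mean : ∀ {n} → RDT n → Vec Bool n → ℚ
mean (leaf v)        x = value v
mean (query i T₀ T₁) x = if lookup x i then mean T₁ x else mean T₀ x
mean (coin T₀ T₁)    x = ½ ℚ.* (mean T₀ x ℚ.+ mean T₁ x)

mean-restrict : ∀ {n} (i : Fin n) b T x → mean (restrict i b T) x ≡ mean T (x [ i ]≔ b)
mean-restrict i b (leaf v)     x = refl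
mean-restrict i b (coin T₀ T₁) x =
  cong₂ (λ p q → ½ ℚ.* (p ℚ.+ q)) (mean-restrict i b T₀ x) (mean-restrict i b T₁ x)
mean-restrict i b (query j T₀ T₁) x with i Finₚ.≟ j
... | no i≢j rewrite Vecₚ.lookup∘update′ (λ j≡i → i≢j (sym j≡i)) x b =
  cong₂ (if_then_else_ (lookup x j)) (mean-restrict i b T₁ x) (mean-restrict i b T₀ x)
mean-restrict i b (query j T₀ T₁) x | yes refl rewrite Vecₚ.lookup∘update i x b with b
... | false = mean-restrict i false T₀ x
... | true  = mean-restrict i true T₁ x

½+½ : ∀ p → ½ ℚ.* (p ℚ.+ p) ≡ p
½+½ p = trans (ℚₚ.*-distribˡ-+ ½ p p)
  (trans (sym (ℚₚ.*-distribʳ-+ p ½ ½)) (ℚₚ.*-identityˡ p))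

ℕ⇒ℚ-2^suc : ∀ m → ℕ⇒ℚ (2 ^ suc m) ≡ ℕ⇒ℚ (2 ^ m) ℚ.+ ℕ⇒ℚ (2 ^ m)
ℕ⇒ℚ-2^suc m = trans (cong (λ k → ℕ⇒ℚ (2 ^ m + k)) (+-identityʳ (2 ^ m)))
                    (ℕ⇒ℚ-+ (2 ^ m) (2 ^ m))

∑-const : ∀ m p → ∑ m (λ _ → p) ≡ ℕ⇒ℚ (2 ^ m) ℚ.* p
∑-const zero    p = sym (ℚₚ.*-identityˡ p)
∑-const (suc m) p = trans (cong₂ ℚ._+_ (∑-const m p) (∑-const m p))
  (trans (sym (ℚₚ.*-distribʳ-+ p (ℕ⇒ℚ (2 ^ m)) (ℕ⇒ℚ (2 ^ m))))
         (cong (ℚ._* p) (sym (ℕ⇒ℚ-2^suc m))))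

∑-cong : ∀ m {f g : Vec Bool m → ℚ} → (∀ r → f r ≡ g r) → ∑ m f ≡ ∑ m g
∑-cong zero    h = h []
∑-cong (suc m) h = cong₂ ℚ._+_ (∑-cong m (λ r → h (false ∷ r))) (∑-cong m (λ r → h (true ∷ r)))

-- Stated for any number m of bits, as unused bits do not change the mean.
∑-run : ∀ {n} (T : RDT n) x {m} (h : randomness T ≤ m) →
        ∑ m (λ r → value (run T x h r)) ≡ ℕ⇒ℚ (2 ^ m) ℚ.* mean T x
∑-run (leaf v)        x {m} h = ∑-const m (value v)
∑-run (query i T₀ T₁) x {m} h with lookup x i
... | false = ∑-run T₀ x {m} (m⊔n≤o⇒m≤o (randomness T₀) (randomness T₁) h)
... | true  = ∑-run T₁ x {m} (m⊔n≤o⇒n≤o (randomness T₀) (randomness T₁) h)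
∑-run (coin T₀ T₁) x {suc m} (s≤s h) = begin
  ∑ m (λ r → value (run T₀ x _ r)) ℚ.+ ∑ m (λ r → value (run T₁ x _ r))
    ≡⟨ cong₂ ℚ._+_ (∑-run T₀ x {m} (m⊔n≤o⇒m≤o (randomness T₀) (randomness T₁) h))
                   (∑-run T₁ x {m} (m⊔n≤o⇒n≤o (randomness T₀) (randomness T₁) h)) ⟩
  w ℚ.* mean T₀ x ℚ.+ w ℚ.* mean T₁ x
    ≡⟨ ℚₚ.*-distribˡ-+ w _ _ ⟨
  w ℚ.* (mean T₀ x ℚ.+ mean T₁ x)
    ≡⟨ cong (ℚ._* (mean T₀ x ℚ.+ mean T₁ x)) (½+½ w) ⟨
  (½ ℚ.* (w ℚ.+ w)) ℚ.* (mean T₀ x ℚ.+ mean T₁ x)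
    ≡⟨ cong (ℚ._* (mean T₀ x ℚ.+ mean T₁ x)) (ℚₚ.*-comm ½ (w ℚ.+ w)) ⟩
  ((w ℚ.+ w) ℚ.* ½) ℚ.* (mean T₀ x ℚ.+ mean T₁ x)
    ≡⟨ ℚₚ.*-assoc (w ℚ.+ w) ½ _ ⟩
  (w ℚ.+ w) ℚ.* mean (coin T₀ T₁) x
    ≡⟨ cong (ℚ._* mean (coin T₀ T₁) x) (ℕ⇒ℚ-2^suc m) ⟨
  ℕ⇒ℚ (2 ^ suc m) ℚ.* mean (coin T₀ T₁) x ∎
  where
  open ≡-Reasoning
  w : ℚ
  w = ℕ⇒ℚ (2 ^ m)

value-μ : ∀ {n} (R : RDT n) x → value (μ R x) ≡ mean R x
value-μ R x = begin
  ∑ m (λ r → value (⟦ R ⟧ᴿ x r)) ℚ.* 2^- m ≡⟨ cong (ℚ._* 2^- m) (∑-run R x ≤-refl) ⟩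
  (w ℚ.* mean R x) ℚ.* 2^- m               ≡⟨ cong (ℚ._* 2^- m) (ℚₚ.*-comm w (mean R x)) ⟩
  (mean R x ℚ.* w) ℚ.* 2^- m               ≡⟨ ℚₚ.*-assoc (mean R x) w (2^- m) ⟩
  mean R x ℚ.* (w ℚ.* 2^- m)               ≡⟨ cong (mean R x ℚ.*_) (ℕ⇒ℚ-inverse (2 ^ m) {{m^n≢0 2 m}}) ⟩
  mean R x ℚ.* 1ℚ                          ≡⟨ ℚₚ.*-identityʳ (mean R x) ⟩
  mean R x ∎
  where
  open ≡-Reasoning
  m : ℕ
  m = randomness R
  w : ℚ
  w = ℕ⇒ℚ (2 ^ m)

value-⟦⟧ᴰ : ∀ {n} (D : DDT n) x → value (⟦ D ⟧ᴰ x) ≡ mean (tree D) x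
value-⟦⟧ᴰ (ddt T c) x = go c _
  where
  go : ∀ {T} → CoinFree T → (h : randomness T ≤ 0) → value (run T x h []) ≡ mean T x
  go leaf h = refl
  go (query {i} c₀ c₁) h with lookup x i
  ... | false = go c₀ _
  ... | true  = go c₁ _

-- The proofs in [0,1] are irrelevant, so the function d of a natural metric
-- depends on values only.
value-injective : ∀ {u v} → value u ≡ value v → u ≡ v
value-injective {unit p a b} {unit .p a′ b′} refl =
  cong₂ (unit p) (ℚₚ.≤-irrelevant a a′) (ℚₚ.≤-irrelevant b b′)

μ-restrict : ∀ {n} (i : Fin n) b R x → μ (restrict i b R) x ≡ μ R (x [ i ]≔ b)
μ-restrict i b R x = value-injective (trans (value-μ (restrict i b R) x)
  (trans (mean-restrict i b R x) (sym (value-μ R (x [ i ]≔ b)))))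

-- Makes a tree ignore variable i and behave as if it had value b.  Queries of
-- i are kept, with equal subtrees, so that the set of allowed trees defined
-- below is closed under this operation.
forget : ∀ {n} → Fin n → Bool → RDT n → RDT n
forget i b (leaf v)        = leaf v
forget i b (query j T₀ T₁) =
  if does (i Finₚ.≟ j)
  then (if b then query j (forget i b T₁) (forget i b T₁)
             else query j (forget i b T₀) (forget i b T₀))
  else query j (forget i b T₀) (forget i b T₁)
forget i b (coin T₀ T₁)    = coin (forget i b T₀) (forget i b T₁)

mean-forget : ∀ {n} (i : Fin n) b T x → mean (forget i b T) x ≡ mean T (x [ i ]≔ b)
mean-forget i b (leaf v)     x = refl
mean-forget i b (coin T₀ T₁) x =
  cong₂ (λ p q → ½ ℚ.* (p ℚ.+ q)) (mean-forget i b T₀ x) (mean-forget i b T₁ x)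
mean-forget i b (query j T₀ T₁) x with i Finₚ.≟ j
... | no i≢j rewrite Vecₚ.lookup∘update′ (λ j≡i → i≢j (sym j≡i)) x b =
  cong₂ (if_then_else_ (lookup x j)) (mean-forget i b T₁ x) (mean-forget i b T₀ x)
mean-forget i b (query j T₀ T₁) x | yes refl rewrite Vecₚ.lookup∘update i x b with b
... | false = trans (if-eta (lookup x i)) (mean-forget i false T₀ x)
... | true  = trans (if-eta (lookup x i)) (mean-forget i true T₁ x)

coinFree-forget : ∀ {n} (i : Fin n) b {T} → CoinFree T → CoinFree (forget i b T)
coinFree-forget i b leaf = leaf
coinFree-forget i b (query {j} c₀ c₁) with i Finₚ.≟ j | b
... | no  _ | _     = query (coinFree-forget i _ c₀) (coinFree-forget i _ c₁)
... | yes _ | false = query (coinFree-forget i false c₀) (coinFree-forget i false c₀)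
... | yes _ | true  = query (coinFree-forget i true c₁) (coinFree-forget i true c₁)

forgetᴰ : ∀ {n} → Fin n → Bool → DDT n → DDT n
forgetᴰ i b (ddt T c) = ddt (forget i b T) (coinFree-forget i b c)

queryᴰ : ∀ {n} → Fin n → DDT n → DDT n → DDT n
queryᴰ i (ddt T₀ c₀) (ddt T₁ c₁) = ddt (query i T₀ T₁) (query c₀ c₁)

⟦forgetᴰ⟧ : ∀ {n} (i : Fin n) b D x → ⟦ forgetᴰ i b D ⟧ᴰ x ≡ ⟦ D ⟧ᴰ (x [ i ]≔ b)
⟦forgetᴰ⟧ i b D x = value-injective (trans (value-⟦⟧ᴰ (forgetᴰ i b D) x)
  (trans (mean-forget i b (tree D) x) (sym (value-⟦⟧ᴰ D (x [ i ]≔ b)))))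

-- The subtree below a query that answers b.
select : ∀ {n} → Bool → DDT n → DDT n → DDT n
select b D₀ D₁ = if b then D₁ else D₀

⟦forgetᴰ⟧-query : ∀ {n} (i : Fin n) b D₀ D₁ x →
                  ⟦ forgetᴰ i b (select b D₀ D₁) ⟧ᴰ x ≡ ⟦ queryᴰ i D₀ D₁ ⟧ᴰ (x [ i ]≔ b)
⟦forgetᴰ⟧-query i b D₀ D₁ x = value-injective
  (trans (cong value (⟦forgetᴰ⟧ i b (select b D₀ D₁) x))
  (trans (value-⟦⟧ᴰ (select b D₀ D₁) (x [ i ]≔ b))
  (trans (branch b) (sym (value-⟦⟧ᴰ (queryᴰ i D₀ D₁) (x [ i ]≔ b))))))
  where
  branch : ∀ b → mean (tree (select b D₀ D₁)) (x [ i ]≔ b) ≡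
                 mean (query i (tree D₀) (tree D₁)) (x [ i ]≔ b)
  branch b rewrite Vecₚ.lookup∘update i x b with b
  ... | false = refl
  ... | true  = refl

-- Doubled, so that no division by two is needed.
∑-split : ∀ {n} (i : Fin n) (f : Vec Bool n → ℚ) →
          ∑ n f ℚ.+ ∑ n f ≡ ∑ n (λ x → f (x [ i ]≔ false)) ℚ.+ ∑ n (λ x → f (x [ i ]≔ true))
∑-split {suc n} zero f = interchange p q p q
  where
  p q : ℚ
  p = ∑ n (λ x → f (false ∷ x))
  q = ∑ n (λ x → f (true ∷ x))
∑-split {suc n} (suc i) f = begin
  (p ℚ.+ q) ℚ.+ (p ℚ.+ q)                     ≡⟨ interchange p q p q ⟩
  (p ℚ.+ p) ℚ.+ (q ℚ.+ q)                     ≡⟨ cong₂ ℚ._+_ (∑-split i _) (∑-split i _) ⟩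
  (p′ false ℚ.+ p′ true) ℚ.+ (q′ false ℚ.+ q′ true)
    ≡⟨ interchange (p′ false) (p′ true) (q′ false) (q′ true) ⟩
  (p′ false ℚ.+ q′ false) ℚ.+ (p′ true ℚ.+ q′ true) ∎
  where
  open ≡-Reasoning
  p q : ℚ
  p = ∑ n (λ x → f (false ∷ x))
  q = ∑ n (λ x → f (true ∷ x))
  p′ q′ : Bool → ℚ
  p′ b = ∑ n (λ x → f (false ∷ x [ i ]≔ b))
  q′ b = ∑ n (λ x → f (true ∷ x [ i ]≔ b))

-- Optimal trees

-- The trees over which the recursion optimizes.  A stack K lists for each
-- level the variables that may be queried there; the trees with at most k
-- queries are those allowed by k copies of the list of all variables.
data Allowed {n} : List (List (Fin n)) → RDT n → Set where
  leaf  : ∀ {K v} → Allowed K (leaf v)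
  query : ∀ {is K i T₀ T₁} → i ∈ is → Allowed K T₀ → Allowed K T₁ →
          Allowed (is ∷ K) (query i T₀ T₁)

allowed-queries : ∀ {n} {K} {T : RDT n} → Allowed K T → queries T ≤ length K
allowed-queries leaf            = z≤n
allowed-queries (query _ a₀ a₁) = s≤s (⊔-lub (allowed-queries a₀) (allowed-queries a₁))

allowed-replicate : ∀ {n k} {T : RDT n} → CoinFree T → queries T ≤ k →
                    Allowed (replicate k (allVars n)) T
allowed-replicate leaf h = leaf
allowed-replicate {k = suc k} (query {i} {T₀} {T₁} c₀ c₁) (s≤s h) =
  query (∈-allVars i) (allowed-replicate c₀ (m⊔n≤o⇒m≤o (queries T₀) (queries T₁) h))
                      (allowed-replicate c₁ (m⊔n≤o⇒n≤o (queries T₀) (queries T₁) h))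

allowed-∷ : ∀ {n} {i : Fin n} {is K T} → Allowed (is ∷ K) T → Allowed ((i ∷ is) ∷ K) T
allowed-∷ leaf            = leaf
allowed-∷ (query j a₀ a₁) = query (Any.there j) a₀ a₁

allowed-forget : ∀ {n} (i : Fin n) b {K T} → Allowed K T → Allowed K (forget i b T)
allowed-forget i b leaf = leaf
allowed-forget i b (query {i = j} j∈ a₀ a₁) with i Finₚ.≟ j | b
... | no  _ | _     = query j∈ (allowed-forget i _ a₀) (allowed-forget i _ a₁)
... | yes _ | false = query j∈ (allowed-forget i false a₀) (allowed-forget i false a₀)
... | yes _ | true  = query j∈ (allowed-forget i true a₁) (allowed-forget i true a₁)

≤-other-half : ∀ {a p q} → a ℚ.+ a ≡ p ℚ.+ q → a ℚ.≤ q → p ℚ.≤ a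
≤-other-half {a} {p} {q} eq a≤q with p ℚₚ.≤? a
... | yes p≤a = p≤a
... | no  p≰a = contradiction (ℚₚ.+-mono-<-≤ (ℚₚ.≰⇒> p≰a) a≤q) (ℚₚ.<-irrefl eq)

≤-halve : ∀ {a b} → a ℚ.+ a ℚ.≤ b ℚ.+ b → a ℚ.≤ b
≤-halve {a} {b} h with a ℚₚ.≤? b
... | yes a≤b = a≤b
... | no  a≰b = contradiction (ℚₚ.<-≤-trans (ℚₚ.+-mono-< (ℚₚ.≰⇒> a≰b) (ℚₚ.≰⇒> a≰b)) h)
                              (ℚₚ.<-irrefl refl)

module _ (𝓔 : ErrorMetric) where

  error : ∀ {n} → RDT n → DDT n → ℚ
  error R D = value (𝓔 R D)

  -- Among the trees allowed by K, the tree D has the least error.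
  Optimal : ∀ {n} → List (List (Fin n)) → RDT n → DDT n → Set
  Optimal K R D = Allowed K (tree D) × (∀ D′ → Allowed K (tree D′) → error R D ℚ.≤ error R D′)

  module _ (natural : Natural 𝓔) where

    error-cong : ∀ {n} (R : RDT n) {D D′} → (∀ x → ⟦ D ⟧ᴰ x ≡ ⟦ D′ ⟧ᴰ x) →
                 error R D ≡ error R D′
    error-cong {n} R {D} {D′} D≡D′ = trans (proj₂ natural R D) (trans
      (cong (ℚ._* 2^- n) (∑-cong n (λ x → cong (λ v → value (proj₁ natural (μ R x) v)) (D≡D′ x))))
      (sym (proj₂ natural R D′)))

    -- The error is the average of the errors on the two halves of the cube
    -- given by variable i.
    error-split : ∀ {n} (i : Fin n) (R : RDT n) D (R′ : Bool → RDT n) (D′ : Bool → DDT n) →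
                  (∀ b x → μ (R′ b) x ≡ μ R (x [ i ]≔ b)) →
                  (∀ b x → ⟦ D′ b ⟧ᴰ x ≡ ⟦ D ⟧ᴰ (x [ i ]≔ b)) →
                  error R D ℚ.+ error R D ≡
                  error (R′ false) (D′ false) ℚ.+ error (R′ true) (D′ true)
    error-split {n} i R D R′ D′ R≡ D≡ = begin
      error R D ℚ.+ error R D
        ≡⟨ cong₂ ℚ._+_ (proj₂ natural R D) (proj₂ natural R D) ⟩
      ∑ n f ℚ.* 2^- n ℚ.+ ∑ n f ℚ.* 2^- n
        ≡⟨ ℚₚ.*-distribʳ-+ (2^- n) (∑ n f) (∑ n f) ⟨
      (∑ n f ℚ.+ ∑ n f) ℚ.* 2^- n
        ≡⟨ cong (ℚ._* 2^- n) (∑-split i f) ⟩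
      (∑ n (λ x → f (x [ i ]≔ false)) ℚ.+ ∑ n (λ x → f (x [ i ]≔ true))) ℚ.* 2^- n
        ≡⟨ ℚₚ.*-distribʳ-+ (2^- n) (∑ n (λ x → f (x [ i ]≔ false))) _ ⟩
      ∑ n (λ x → f (x [ i ]≔ false)) ℚ.* 2^- n ℚ.+ ∑ n (λ x → f (x [ i ]≔ true)) ℚ.* 2^- n
        ≡⟨ cong₂ ℚ._+_ (half false) (half true) ⟩
      error (R′ false) (D′ false) ℚ.+ error (R′ true) (D′ true) ∎
      where
      open ≡-Reasoning
      d = proj₁ natural
      f : Vec Bool n → ℚ
      f x = value (d (μ R x) (⟦ D ⟧ᴰ x))

      half : ∀ b → ∑ n (λ x → f (x [ i ]≔ b)) ℚ.* 2^- n ≡ error (R′ b) (D′ b)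
      half b = trans
        (cong (ℚ._* 2^- n) (∑-cong n (λ x → cong₂ (λ u v → value (d u v))
                                              (sym (R≡ b x)) (sym (D≡ b x)))))
        (sym (proj₂ natural (R′ b) (D′ b)))

    error-query : ∀ {n} (i : Fin n) (R : RDT n) D₀ D₁ →
                  error R (queryᴰ i D₀ D₁) ℚ.+ error R (queryᴰ i D₀ D₁) ≡
                  error (restrict i false R) (forgetᴰ i false D₀) ℚ.+
                  error (restrict i true R) (forgetᴰ i true D₁)
    error-query i R D₀ D₁ = error-split i R (queryᴰ i D₀ D₁)
      (λ b → restrict i b R) (λ b → forgetᴰ i b (select b D₀ D₁))
      (λ b → μ-restrict i b R) (λ b → ⟦forgetᴰ⟧-query i b D₀ D₁)

    -- A restricted tree does not depend on i, so the error of D is the average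
    -- of the errors of its two forgetful versions; as neither of these beats
    -- the optimal D, both are equal to it.
    forget-optimal : ∀ {n} (i : Fin n) b {R : RDT n} {K D} → Optimal K (restrict i b R) D →
                     error (restrict i b R) (forgetᴰ i b D) ℚ.≤ error (restrict i b R) D
    forget-optimal i b {R} {K} {D} (allowed , best) = go b best
      where
      invariant : ∀ b c x → μ (restrict i b R) x ≡ μ (restrict i b R) (x [ i ]≔ c)
      invariant b c x = trans (μ-restrict i b R x)
        (trans (cong (μ R) (sym (Vecₚ.[]≔-idempotent x i)))
               (sym (μ-restrict i b R (x [ i ]≔ c))))

      split : ∀ b → let E = error (restrict i b R) in
              E D ℚ.+ E D ≡ E (forgetᴰ i false D) ℚ.+ E (forgetᴰ i true D)
      split b = error-split i (restrict i b R) D (λ _ → restrict i b R) (λ c → forgetᴰ i c D)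
        (invariant b) (λ c → ⟦forgetᴰ⟧ i c D)

      go : ∀ b → (∀ D′ → Allowed K (tree D′) → error (restrict i b R) D ℚ.≤ error (restrict i b R) D′) →
           error (restrict i b R) (forgetᴰ i b D) ℚ.≤ error (restrict i b R) D
      go false best = ≤-other-half (split false) (best _ (allowed-forget i true allowed))
      go true  best = ≤-other-half (trans (split true) (ℚₚ.+-comm (error (restrict i true R) (forgetᴰ i false D)) _))
        (best _ (allowed-forget i false allowed))

    -- Among the trees querying i first, optimal subtrees give an optimal tree.
    query-optimal : ∀ {n} (i : Fin n) {R : RDT n} {K D₀ D₁} →
                    Optimal K (restrict i false R) D₀ → Optimal K (restrict i true R) D₁ →
                    ∀ D₀′ D₁′ → Allowed K (tree D₀′) → Allowed K (tree D₁′) →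
                    error R (queryᴰ i D₀ D₁) ℚ.≤ error R (queryᴰ i D₀′ D₁′)
    query-optimal i {R} o₀ o₁ D₀′ D₁′ a₀ a₁ = ≤-halve
      (subst₂ ℚ._≤_ (sym (error-query i R _ _)) (sym (error-query i R _ _))
        (ℚₚ.≤-trans
          (ℚₚ.+-mono-≤ (forget-optimal i false {R} o₀) (forget-optimal i true {R} o₁))
          (ℚₚ.+-mono-≤ (proj₂ o₀ _ (allowed-forget i false a₀))
                       (proj₂ o₁ _ (allowed-forget i true a₁)))))

    -- C if it is at least as good as D, as decided by C≤D?.
    better : ∀ {n} {A : Set} → Dec A → DDT n → DDT n → DDT n
    better C≤D? D C = if does C≤D? then C else D

    better-optimal : ∀ {n} {i : Fin n} {is R K D D₀ D₁} → Optimal (is ∷ K) R D →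
                     Optimal K (restrict i false R) D₀ → Optimal K (restrict i true R) D₁ →
                     (C≤D? : Dec (error R (queryᴰ i D₀ D₁) ℚ.≤ error R D)) →
                     Optimal ((i ∷ is) ∷ K) R (better C≤D? D (queryᴰ i D₀ D₁))
    better-optimal {i = i} {is} {R} {K} {D} {D₀} {D₁} (allowed , best) o₀ o₁ = result
      where
      C = queryᴰ i D₀ D₁

      cover : ∀ {X} → error R X ℚ.≤ error R D → error R X ℚ.≤ error R C →
              ∀ D′ → Allowed ((i ∷ is) ∷ K) (tree D′) → error R X ℚ.≤ error R D′
      cover X≤D X≤C D′@(ddt _ _) leaf = ℚₚ.≤-trans X≤D (best D′ leaf)
      cover X≤D X≤C D′@(ddt _ _) (query (Any.there j∈) a₀ a₁) =
        ℚₚ.≤-trans X≤D (best D′ (query j∈ a₀ a₁))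
      cover X≤D X≤C (ddt _ (query c₀ c₁)) (query (Any.here refl) a₀ a₁) =
        ℚₚ.≤-trans X≤C (query-optimal i o₀ o₁ (ddt _ c₀) (ddt _ c₁) a₀ a₁)

      result : (C≤D? : Dec (error R C ℚ.≤ error R D)) →
               Optimal ((i ∷ is) ∷ K) R (better C≤D? D C)
      result (yes C≤D) = query (Any.here refl) (proj₁ o₀) (proj₁ o₁) , cover C≤D ℚₚ.≤-refl
      result (no  C≰D) = allowed-∷ allowed , cover ℚₚ.≤-refl (ℚₚ.<⇒≤ (ℚₚ.≰⇒> C≰D))

-- Computing restrictions

-- Input cons b (cons i T).  The first three cases take the input apart, and the
-- next ones distinguish leaf, query and coin by the tag of T: nil, or a
-- digit which is nil for a query and a cons for a coin.
restrictP : Program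
restrictP = case v0 nil (case v1 nil (case v1 nil
  (case v0
    v3
    (case v3 nil
      (case v2
        (case v1 nil
          (let′ (call equalP (cons v8 v2))
            (case v0
              (cons v7 (cons v3 (cons (self (cons v11 (cons v9 v1)))
                                      (self (cons v11 (cons v9 v2))))))
              (case v13
                (self (cons v13 (cons v11 v3)))
                (self (cons v15 (cons v13 v6)))))))
        (cons v6 (cons (self (cons v10 (cons v8 v2)))
                       (self (cons v10 (cons v8 v3))))))))))

restrictS restrictT : ∀ {k} → Poly k → Poly k
restrictS L = L ⊕ equalT L
restrictT L = activations restrictP L (restrictS L)

-- The number of activations of restrictP on T is at most its number of nodes.
nodes : ∀ {n} → RDT n → ℕ
nodes (leaf v)        = 1
nodes (query i T₀ T₁) = suc (nodes T₀ + nodes T₁)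
nodes (coin T₀ T₁)    = suc (nodes T₀ + nodes T₁)

nodes≤size : ∀ {n} (T : RDT n) → nodes T ≤ size (encRDT T)
nodes≤size (leaf v)        = s≤s z≤n
nodes≤size (query i T₀ T₁) = m≤n⇒m≤o+n 5 (m≤n⇒m≤o+n (size (encℕ (toℕ i)))
  (s≤s (+-mono-≤ (nodes≤size T₀) (nodes≤size T₁))))
nodes≤size (coin T₀ T₁)    = m≤n⇒m≤o+n 6 (s≤s (+-mono-≤ (nodes≤size T₀) (nodes≤size T₁)))

restrictP-correct : ∀ {k} {a : Vec ℕ k} L {n} b (i : Fin n) T →
                    size (cons (encBool b) (cons (encℕ (toℕ i)) (encRDT T))) ≤ ⟦ L ⟧ᴾ a →
                    restrictP on cons (encBool b) (cons (encℕ (toℕ i)) (encRDT T))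
                      returns encRDT (restrict i b T) within ⟦ restrictT L ⟧ᴾ a
restrictP-correct {a = a} L {n} b i T h =
  total L (restrictS L) (go T h) (≤-trans (nodes≤size T) (≤-trans (tree-≤ T) h))
  where
  ℓ s : ℕ
  ℓ = ⟦ L ⟧ᴾ a
  s = ⟦ restrictS L ⟧ᴾ a

  input : RDT n → Tree
  input T = cons (encBool b) (cons (encℕ (toℕ i)) (encRDT T))

  var-≤ : ∀ T → size (encℕ (toℕ i)) ≤ size (input T)
  var-≤ T = m≤n⇒m≤1+n (m≤n⇒m≤o+n (size (encBool b)) (m≤n⇒m≤1+n (m≤m+n _ _)))

  tree-≤ : ∀ T → size (encRDT T) ≤ size (input T)
  tree-≤ T = m≤n⇒m≤1+n (m≤n⇒m≤o+n (size (encBool b))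
    (m≤n⇒m≤1+n (m≤n+m _ (size (encℕ (toℕ i))))))

  shrink : ∀ T T′ → size (encRDT T′) ≤ size (encRDT T) → size (input T) ≤ ℓ → size (input T′) ≤ ℓ
  shrink T T′ h = ≤-trans (s≤s (+-monoʳ-≤ (size (encBool b))
    (s≤s (+-monoʳ-≤ (size (encℕ (toℕ i))) h))))

  fits : ∀ T → size (input T) ≤ ℓ → size (input T) ≤ s
  fits T = m≤n⇒m≤n+o _

  go : ∀ T → size (input T) ≤ ℓ →
       restrictP at s on input T returns encRDT (restrict i b T) after nodes T
  go (leaf v) h = activate (fits (leaf v) h)
    (↓case-cons refl (↓case-cons refl (↓case-cons refl (↓case-nil refl (↓var _))))) ≤-refl
  go T@(coin T₀ T₁) h = activate (fits T h)
    (↓case-cons refl (↓case-cons refl (↓case-cons refl (↓case-cons refl (↓case-cons refl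
      (↓case-cons refl
        (↓cons (↓var _)
          (↓cons (↓self (↓cons (↓var _) (↓cons (↓var _) (↓var _)))
                   (go T₀ (shrink T T₀ (m≤n⇒m≤o+n 7 (m≤m+n _ _)) h)))
                 (↓self (↓cons (↓var _) (↓cons (↓var _) (↓var _)))
                   (go T₁ (shrink T T₁ (m≤n⇒m≤o+n 7 (m≤n+m _ (size (encRDT T₀)))) h)))))))))))
    ≤-refl
  go T@(query j T₀ T₁) h = branch (i Finₚ.≟ j) b refl test
    where
    child₀ : size (encRDT T₀) ≤ size (encRDT T)
    child₀ = m≤n⇒m≤o+n 5 (m≤n⇒m≤o+n (size (encℕ (toℕ j))) (m≤n⇒m≤1+n (m≤m+n _ _)))

    child₁ : size (encRDT T₁) ≤ size (encRDT T)
    child₁ = m≤n⇒m≤o+n 5 (m≤n⇒m≤o+n (size (encℕ (toℕ j)))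
      (m≤n⇒m≤1+n (m≤n+m _ (size (encRDT T₀)))))

    test : equalP on cons (encℕ (toℕ i)) (encℕ (toℕ j)) returns encBool (does (i Finₚ.≟ j)) within s
    test = weaken (⊴-≤ (restrictS L) (right here)) (equalP-correct L i j
      (≤-trans (var-≤ T) h)
      (≤-trans (m≤n⇒m≤o+n 5 (m≤m+n _ _)) (≤-trans (tree-≤ T) h)))

    recurse₀ = go T₀ (shrink T T₀ child₀ h)
    recurse₁ = go T₁ (shrink T T₁ child₁ h)

    -- A match on c, with its equation, determines b.
    branch : ∀ (i≟j : Dec (i ≡ j)) c → c ≡ b →
             equalP on cons (encℕ (toℕ i)) (encℕ (toℕ j)) returns encBool (does i≟j) within s →
             restrictP at s on input T
               returns encRDT (if does i≟j then (if b then restrict i b T₁ else restrict i b T₀)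
                               else query j (restrict i b T₀) (restrict i b T₁))
               after nodes T
    branch (no _) c eq r = activate (fits T h)
      (↓case-cons refl (↓case-cons refl (↓case-cons refl (↓case-cons refl (↓case-cons refl
        (↓case-nil refl (↓case-cons refl
          (↓let (output-size r) (↓call (↓cons (↓var _) (↓var _)) r)
            (↓case-nil refl
              (↓cons (↓var _) (↓cons (↓var _)
                (↓cons (↓self (↓cons (↓var _) (↓cons (↓var _) (↓var _))) recurse₀)
                       (↓self (↓cons (↓var _) (↓cons (↓var _) (↓var _))) recurse₁)))))))))))))
      ≤-refl
    branch (yes _) false refl r = activate (fits T h)
      (↓case-cons refl (↓case-cons refl (↓case-cons refl (↓case-cons refl (↓case-cons refl
        (↓case-nil refl (↓case-cons refl
          (↓let (output-size r) (↓call (↓cons (↓var _) (↓var _)) r)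
            (↓case-cons refl (↓case-nil refl
              (↓self (↓cons (↓var _) (↓cons (↓var _) (↓var _))) recurse₀)))))))))))
      (s≤s (m≤m+n _ _))
    branch (yes _) true refl r = activate (fits T h)
      (↓case-cons refl (↓case-cons refl (↓case-cons refl (↓case-cons refl (↓case-cons refl
        (↓case-nil refl (↓case-cons refl
          (↓let (output-size r) (↓call (↓cons (↓var _) (↓var _)) r)
            (↓case-cons refl (↓case-cons refl
              (↓self (↓cons (↓var _) (↓cons (↓var _) (↓var _))) recurse₁)))))))))))
      (s≤s (m≤n+m _ (nodes T₀)))

-- Composition of polynomials

infix 8 _⟪_⟫

_⟪_⟫ : ∀ {j k} → Poly k → Vec (Poly j) k → Poly j
con c   ⟪ σ ⟫ = con c
var i   ⟪ σ ⟫ = lookup σ i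
(P ⊕ Q) ⟪ σ ⟫ = P ⟪ σ ⟫ ⊕ Q ⟪ σ ⟫
(P ⊗ Q) ⟪ σ ⟫ = P ⟪ σ ⟫ ⊗ Q ⟪ σ ⟫

⟪⟫-≤ : ∀ {j k} {a : Vec ℕ j} {b : Vec ℕ k} (P : Poly k) (σ : Vec (Poly j) k) →
       Pointwise (λ x Q → x ≤ ⟦ Q ⟧ᴾ a) b σ → ⟦ P ⟧ᴾ b ≤ ⟦ P ⟪ σ ⟫ ⟧ᴾ a
⟪⟫-≤ (con c) σ h = ≤-refl
⟪⟫-≤ (var i) σ h = Pointwise.lookup h i
⟪⟫-≤ (P ⊕ Q) σ h = +-mono-≤ (⟪⟫-≤ P σ h) (⟪⟫-≤ Q σ h)
⟪⟫-≤ (P ⊗ Q) σ h = *-mono-≤ (⟪⟫-≤ P σ h) (⟪⟫-≤ Q σ h)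

-- The recursion on the depth

encStack : ∀ {n} → List (List (Fin n)) → Tree
encStack []       = nil
encStack (is ∷ K) = cons (encVars is) (encStack K)

-- The number of activations of the recursive program below on stack K.
calls : ∀ {n} → List (List (Fin n)) → ℕ
calls []             = 1
calls ([] ∷ K)       = 1
calls ((i ∷ is) ∷ K) = suc (calls (is ∷ K) + (calls K + calls K))

calls-≥1 : ∀ {n} (K : List (List (Fin n))) → 1 ≤ calls K
calls-≥1 []            = ≤-refl
calls-≥1 ([] ∷ K)      = ≤-refl
calls-≥1 ((_ ∷ _) ∷ K) = s≤s z≤n

calls-∷ : ∀ {n} (is : List (Fin n)) K → calls (is ∷ K) ≤ (1 + 3 * length is) * calls K
calls-∷ []       K = ≤-trans (calls-≥1 K) (m≤m+n _ _)
calls-∷ (i ∷ is) K = ≤-trans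
  (+-mono-≤ (calls-≥1 K) (+-monoˡ-≤ _ (calls-∷ is K)))
  (≤-reflexive (eq (length is) (calls K)))
  where
  eq : ∀ l c → c + ((1 + 3 * l) * c + (c + c)) ≡ (1 + 3 * suc l) * c
  eq = solve-∀

module Algorithm (t : ℕ → ℕ) (𝓔 : ErrorMetric) (natural : Natural 𝓔) (efficient : Efficient t 𝓔) where

  open Efficient efficient

  evaluateP bestConstantP : Program
  evaluateP     = proj₁ evaluate
  bestConstantP = proj₁ bestConstant

  -- On a stack K and the description of R, an optimal tree allowed by K.  If no
  -- variable is left at the top level, this is the best constant.  Otherwise
  -- let i be the first variable there: the candidates are the optimal tree D
  -- for the stack without i, and the query C of i above optimal trees for the
  -- two restrictions of R and the remaining levels.
  buildP : Program
  buildP = case v0 nil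
    (case v0
      (cons nil (call bestConstantP v1))
      (case v0
        (cons nil (call bestConstantP v3))
        (case v5 nil
          -- the tree D
          (let′ (self (cons (cons v3 v5) v7))
          -- the subtree for i = 0
          (let′ (self (cons v6 (cons v1 (call restrictP (cons nil (cons v3 v2))))))
          -- the tree C, with the subtree for i = 1
          (let′ (cons mark (cons v4 (cons v0
                  (self (cons v7 (cons v2 (call restrictP (cons mark (cons v4 v3)))))))))
          (let′ (call evaluateP (cons v10 (cons v3 v0)))
          (let′ (call leqP (cons v0 (call evaluateP (cons v11 (cons v4 v3)))))
            -- v4 is D in the first branch and C in the second
            (case v0 v4 v4)))))))))

  -- The polynomials N, τ, κ and Y bound the description length of R, the value
  -- t q, the size of the stack and the number of activations.
  module _ {k : ℕ} (N τ κ Y : Poly k) where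

    -- cellZ bounds the part of the output written by one activation.
    constantT cellZ treeZ evaluateT buildS buildT : Poly k
    constantT = proj₁ (proj₂ bestConstant) ⟪ τ ∷ N ∷ [] ⟫
    cellZ     = con 6 ⊕ κ ⊕ constantT
    treeZ     = Y ⊗ cellZ
    evaluateT = proj₁ (proj₂ evaluate) ⟪ τ ∷ N ∷ con 1 ⊕ N ⊕ treeZ ∷ [] ⟫
    buildS    = con 1 ⊕ (κ ⊕ N) ⊕ treeZ ⊕ restrictT (con 5 ⊕ (κ ⊕ N)) ⊕
                constantT ⊕ evaluateT ⊕ leqT evaluateT
    buildT    = activations buildP Y buildS

  module Build {k : ℕ} {a : Vec ℕ k} (N τ κ Y : Poly k) {n : ℕ} (q : ℕ) (t≤ : t q ≤ ⟦ τ ⟧ᴾ a) where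

    s cell : ℕ
    s    = ⟦ buildS N τ κ Y ⟧ᴾ a
    cell = ⟦ cellZ N τ κ Y ⟧ᴾ a

    -- The assumptions under which the bounds hold for R and K.
    Within : List (List (Fin n)) → RDT n → Set
    Within K R = queries R ≤ q × descriptionLength R ≤ ⟦ N ⟧ᴾ a ×
                 size (encStack K) ≤ ⟦ κ ⟧ᴾ a × calls K ≤ ⟦ Y ⟧ᴾ a

    -- D is an optimal tree found by buildP; its size is bounded through the
    -- number of activations, since each writes one node.
    Built : List (List (Fin n)) → RDT n → DDT n → Set
    Built K R D = Optimal 𝓔 K R D × size (encRDT (tree D)) ≤ calls K * cell ×
                  buildP at s on cons (encStack K) (describe R) returns encRDT (tree D) after calls K

    fits : ∀ (K : List (List (Fin n))) (D : DDT n) → calls K ≤ ⟦ Y ⟧ᴾ a →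
           size (encRDT (tree D)) ≤ calls K * cell →
           size (encRDT (tree D)) ≤ ⟦ treeZ N τ κ Y ⟧ᴾ a
    fits K D c≤ h = ≤-trans h (*-monoˡ-≤ cell c≤)

    evaluation : ∀ (R : RDT n) D → queries R ≤ q → descriptionLength R ≤ ⟦ N ⟧ᴾ a →
                 size (encRDT (tree D)) ≤ ⟦ treeZ N τ κ Y ⟧ᴾ a →
                 evaluateP on cons (describe R) (describe (tree D))
                   returns encℚ (error 𝓔 R D) within ⟦ evaluateT N τ κ Y ⟧ᴾ a
    evaluation R D hq hN hD = weaken
      (⟪⟫-≤ (proj₁ (proj₂ evaluate)) _ (t≤ ∷ hN ∷ s≤s (+-mono-≤ n≤ hD) ∷ []))
      (proj₂ (proj₂ evaluate) q R D hq)
      where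
      n≤ : size (encℕ n) ≤ ⟦ N ⟧ᴾ a
      n≤ = ≤-trans (m≤n⇒m≤1+n (m≤m+n _ _)) hN

    constant : ∀ (R : RDT n) → queries R ≤ q → descriptionLength R ≤ ⟦ N ⟧ᴾ a →
      Σ[ c ∈ [0,1] ] (∀ c′ → error 𝓔 R (const c) ℚ.≤ error 𝓔 R (const c′)) ×
        bestConstantP on describe R returns encℚ (value c) within ⟦ constantT N τ κ Y ⟧ᴾ a
    constant R hq hN with c , best , r ← proj₂ (proj₂ bestConstant) q R hq =
      c , best , weaken (⟪⟫-≤ (proj₁ (proj₂ bestConstant)) _ (t≤ ∷ hN ∷ [])) r

    input : ∀ K R → Within K R → size (cons (encStack K) (describe R)) ≤ s
    input _ _ (_ , hN , hκ , _) = ≤-trans (s≤s (+-mono-≤ hκ hN))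
      (⊴-≤ {P = con 1 ⊕ (κ ⊕ N)} (buildS N τ κ Y) (left (left (left (left (left here))))))

    constant-size : ∀ c → size (encℚ (value c)) ≤ ⟦ constantT N τ κ Y ⟧ᴾ a →
                    size (encRDT {n} (leaf c)) ≤ 1 * cell
    constant-size c h = ≤-trans (s≤s (s≤s h)) (≤-trans
      (+-monoˡ-≤ (⟦ constantT N τ κ Y ⟧ᴾ a) {2} {6 + ⟦ κ ⟧ᴾ a} (s≤s (s≤s z≤n)))
      (m≤m+n cell 0))

    build : ∀ K R → Within K R → Σ[ D ∈ DDT n ] Built K R D
    build [] R w@(hq , hN , _) with c , best , r ← constant R hq hN =
      const c ,
      (leaf , λ { (ddt _ leaf) leaf → best _ }) ,
      constant-size c (output-size r) ,
      activate (input [] R w)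
        (↓case-cons refl (↓case-nil refl (↓cons ↓nil (↓call (↓var _)
          (weaken (⊴-≤ (buildS N τ κ Y) (left (left (right here)))) r))))) ≤-refl
    build ([] ∷ K) R w@(hq , hN , _) with c , best , r ← constant R hq hN =
      const c ,
      (leaf , λ { (ddt _ leaf) leaf → best _ }) ,
      constant-size c (output-size r) ,
      activate (input ([] ∷ K) R w)
        (↓case-cons refl (↓case-cons refl (↓case-nil refl (↓cons ↓nil (↓call (↓var _)
          (weaken (⊴-≤ (buildS N τ κ Y) (left (left (right here)))) r)))))) ≤-refl
    build ((i ∷ is) ∷ K) R w@(hq , hN , hκ , hY) = assemble
      (build (is ∷ K) R (hq , hN , is≤ , ≤-trans (m≤n⇒m≤1+n (m≤m+n _ _)) hY))
      (build K (restrict i false R) (within false))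
      (build K (restrict i true R) (within true))
      where
      is≤ : size (encStack (is ∷ K)) ≤ ⟦ κ ⟧ᴾ a
      is≤ = ≤-trans (s≤s (+-monoˡ-≤ (size (encStack K))
        (m≤n⇒m≤1+n (m≤n+m (size (encVars is)) (size (encℕ (toℕ i))))))) hκ

      K≤ : size (encStack K) ≤ ⟦ κ ⟧ᴾ a
      K≤ = ≤-trans (m≤n⇒m≤1+n (m≤n+m _ (size (encVars (i ∷ is))))) hκ

      i≤ : size (encℕ (toℕ i)) ≤ ⟦ κ ⟧ᴾ a
      i≤ = ≤-trans (m≤n⇒m≤1+n (m≤n⇒m≤n+o _ (m≤n⇒m≤1+n (m≤m+n _ _)))) hκ

      calls-K : calls K ≤ ⟦ Y ⟧ᴾ a
      calls-K = ≤-trans (m≤n⇒m≤1+n (m≤n⇒m≤o+n (calls (is ∷ K)) (m≤m+n _ _))) hY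

      calls-is : calls (is ∷ K) ≤ ⟦ Y ⟧ᴾ a
      calls-is = ≤-trans (m≤n⇒m≤1+n (m≤m+n _ _)) hY

      within : ∀ b → Within K (restrict i b R)
      within b = ≤-trans (queries-restrict i b R) hq ,
        ≤-trans (s≤s (+-monoʳ-≤ (size (encℕ n)) (size-restrict i b R))) hN , K≤ , calls-K

      restriction : ∀ b → restrictP on cons (encBool b) (cons (encℕ (toℕ i)) (encRDT R))
                            returns encRDT (restrict i b R) within s
      restriction b = weaken (⊴-≤ (buildS N τ κ Y) (left (left (left (right here)))))
        (restrictP-correct (con 5 ⊕ (κ ⊕ N)) b i R
          (s≤s (+-mono-≤ (flag b) (s≤s (+-mono-≤ i≤ R≤)))))
        where
        flag : ∀ b → size (encBool b) ≤ 3
        flag false = s≤s z≤n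
        flag true  = ≤-refl
        R≤ : size (encRDT R) ≤ ⟦ N ⟧ᴾ a
        R≤ = ≤-trans (m≤n⇒m≤1+n (m≤n+m _ (size (encℕ n)))) hN

      assemble : Σ[ D ∈ DDT n ] Built (is ∷ K) R D →
                 Σ[ D ∈ DDT n ] Built K (restrict i false R) D →
                 Σ[ D ∈ DDT n ] Built K (restrict i true R) D →
                 Σ[ D ∈ DDT n ] Built ((i ∷ is) ∷ K) R D
      assemble (D , oD , zD , rD) (D₀ , o₀ , z₀ , r₀) (D₁ , o₁ , z₁ , r₁) =
        better 𝓔 natural C≤D? D C , better-optimal 𝓔 natural oD o₀ o₁ C≤D? ,
        chosen-size C≤D? , run-build C≤D? compare
        where
        C : DDT n
        C = queryᴰ i D₀ D₁

        C≤D? : Dec (error 𝓔 R C ℚ.≤ error 𝓔 R D)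
        C≤D? = error 𝓔 R C ℚₚ.≤? error 𝓔 R D

        c c′ : ℕ
        c  = calls (is ∷ K)
        c′ = calls K

        size-C : size (encRDT (tree C)) ≤ calls ((i ∷ is) ∷ K) * cell
        size-C = begin
          size (encRDT (tree C))
            ≡⟨ shape (size (encℕ (toℕ i))) (size (encRDT (tree D₀))) (size (encRDT (tree D₁))) ⟩
          (6 + size (encℕ (toℕ i))) + (size (encRDT (tree D₀)) + size (encRDT (tree D₁)))
            ≤⟨ +-mono-≤ (≤-trans (+-monoʳ-≤ 6 i≤) (m≤m+n _ (⟦ constantT N τ κ Y ⟧ᴾ a)))
                        (+-mono-≤ z₀ z₁) ⟩
          cell + (c′ * cell + c′ * cell)
            ≡⟨ collect c′ cell ⟩
          suc (c′ + c′) * cell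
            ≤⟨ *-monoˡ-≤ cell (s≤s (m≤n+m (c′ + c′) c)) ⟩
          calls ((i ∷ is) ∷ K) * cell ∎
          where
          open ≤-Reasoning
          shape : ∀ x y z → 5 + (x + suc (y + z)) ≡ (6 + x) + (y + z)
          shape = solve-∀
          collect : ∀ c x → x + (c * x + c * x) ≡ suc (c + c) * x
          collect = solve-∀

        chosen-size : ∀ {A : Set} (d : Dec A) →
                      size (encRDT (tree (better 𝓔 natural d D C))) ≤ calls ((i ∷ is) ∷ K) * cell
        chosen-size (yes _) = size-C
        chosen-size (no  _) = ≤-trans zD (*-monoˡ-≤ cell (m≤n⇒m≤1+n (m≤m+n c (c′ + c′))))

        tree-≤ : ∀ (X : DDT n) → size (encRDT (tree X)) ≤ ⟦ treeZ N τ κ Y ⟧ᴾ a →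
                 size (encRDT (tree X)) ≤ s
        tree-≤ X h = ≤-trans h
          (⊴-≤ {P = treeZ N τ κ Y} (buildS N τ κ Y) (left (left (left (left (right here))))))

        D≤ : size (encRDT (tree D)) ≤ ⟦ treeZ N τ κ Y ⟧ᴾ a
        D≤ = fits (is ∷ K) D calls-is zD

        C≤ : size (encRDT (tree C)) ≤ ⟦ treeZ N τ κ Y ⟧ᴾ a
        C≤ = fits ((i ∷ is) ∷ K) C hY size-C

        score : ∀ X → size (encRDT (tree X)) ≤ ⟦ treeZ N τ κ Y ⟧ᴾ a →
                evaluateP on cons (describe R) (describe (tree X))
                  returns encℚ (error 𝓔 R X) within s
        score X h = weaken (⊴-≤ (buildS N τ κ Y) (left (right here))) (evaluation R X hq hN h)

        compare : leqP on cons (encℚ (error 𝓔 R C)) (encℚ (error 𝓔 R D))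
                    returns encBool (does C≤D?) within s
        compare = weaken (⊴-≤ (buildS N τ κ Y) (right here))
          (leqP-correct (evaluateT N τ κ Y) _ _ (0≤value (𝓔 R C)) (0≤value (𝓔 R D))
            (output-size (evaluation R C hq hN C≤)) (output-size (evaluation R D hq hN D≤)))

        run-build : ∀ {A : Set} (d : Dec A) →
          leqP on cons (encℚ (error 𝓔 R C)) (encℚ (error 𝓔 R D)) returns encBool (does d) within s →
          buildP at s on cons (encStack ((i ∷ is) ∷ K)) (describe R)
            returns encRDT (tree (better 𝓔 natural d D C)) after calls ((i ∷ is) ∷ K)
        run-build d r = activate (input ((i ∷ is) ∷ K) R w)
          (↓case-cons refl (↓case-cons refl (↓case-cons refl (↓case-cons refl
            (↓let (tree-≤ D D≤) (↓self (↓cons (↓cons (↓var _) (↓var _)) (↓var _)) rD)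
            (↓let (tree-≤ D₀ (fits K D₀ calls-K z₀))
              (↓self (↓cons (↓var _) (↓cons (↓var _)
                (↓call (↓cons ↓nil (↓cons (↓var _) (↓var _))) (restriction false)))) r₀)
            (↓let (tree-≤ C C≤)
              (↓cons (↓cons ↓nil ↓nil) (↓cons (↓var _) (↓cons (↓var _)
                (↓self (↓cons (↓var _) (↓cons (↓var _)
                  (↓call (↓cons (↓cons ↓nil ↓nil) (↓cons (↓var _) (↓var _))) (restriction true)))) r₁))))
            (↓let (output-size (score C C≤))
              (↓call (↓cons (↓var _) (↓cons (↓var _) (↓var _))) (score C C≤))
            (↓let (output-size r)
              (↓call (↓cons (↓var _) (↓call (↓cons (↓var _) (↓cons (↓var _) (↓var _))) (score D D≤))) r)
              (choose d))))))))))
          (s≤s (≤-reflexive (cong (λ x → c + (c′ + x)) (+-identityʳ c′))))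
          where
          choose : ∀ {A : Set} {m} {ρ : Vec Tree m} {x y z} (d : Dec A) →
                   buildP at s ∣ encBool (does d) ∷ x ∷ encRDT (tree C) ∷ y ∷ encRDT (tree D) ∷ z ∷ ρ
                     ⊢ case v0 v4 v4 ⇓ encRDT (tree (better 𝓔 natural d D C)) ⟨ 0 ⟩
          choose (yes _) = ↓case-cons refl (↓var _)
          choose (no  _) = ↓case-nil refl (↓var _)

    build-time : ∀ K R → Within K R →
      Σ[ D ∈ DDT n ] Optimal 𝓔 K R D × size (encRDT (tree D)) ≤ ⟦ treeZ N τ κ Y ⟧ᴾ a ×
        buildP on cons (encStack K) (describe R) returns encRDT (tree D) within ⟦ buildT N τ κ Y ⟧ᴾ a
    build-time K R w@(_ , _ , _ , hY) with D , o , z , r ← build K R w =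
      D , o , fits K D hY z , total Y (buildS N τ κ Y) r hY

-- Searching for the query complexity

-- The stack that allows all trees with at most j queries.
fullStack : ∀ n → ℕ → List (List (Fin n))
fullStack n j = replicate j (allVars n)

size-fullStack : ∀ n j → size (encStack (fullStack n j)) ≤ 1 + j * (2 + n * (2 + 4 * n))
size-fullStack n zero    = ≤-refl
size-fullStack n (suc j) = s≤s (≤-trans
  (+-mono-≤ (size-encVars-below {n} n ≤-refl) (size-fullStack n j))
  (≤-reflexive (+-suc (1 + n * (2 + 4 * n)) (j * (2 + n * (2 + 4 * n))))))

calls-fullStack : ∀ n j → calls (fullStack n j) ≤ (1 + 3 * n) ^ j
calls-fullStack n zero    = ≤-refl
calls-fullStack n (suc j) = ≤-trans (calls-∷ (allVars n) (fullStack n j))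
  (*-mono-≤ (≤-reflexive (cong (λ l → 1 + 3 * l) (length-below {n} n ≤-refl))) (calls-fullStack n j))

^-distribʳ-* : ∀ m n o → (m * n) ^ o ≡ m ^ o * n ^ o
^-distribʳ-* m n zero    = refl
^-distribʳ-* m n (suc o) = trans (cong ((m * n) *_) (^-distribʳ-* m n o))
  ([m*n]*[o*p]≡[m*o]*[n*p] m n (m ^ o) (n ^ o))

-- What is needed of w = n ^ q, for q the optimal number of queries, to bound
-- the time of the search polynomially in w.
record Dominated (n q : ℕ) : Set where
  field
    depth-≤    : q ≤ n ^ q
    vars-≤     : 1 ≤ q → n ≤ n ^ q
    branches-≤ : (1 + 3 * n) ^ q ≤ 4 * (n ^ q * n ^ q * n ^ q)

dominated-≥2 : ∀ n q → 2 ≤ n → Dominated n q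
dominated-≥2 n q 2≤n = record
  { depth-≤ = <⇒≤ (q<n^q q) ; vars-≤ = n≤n^q q ; branches-≤ = branches }
  where
  1≤n : 1 ≤ n
  1≤n = <⇒≤ 2≤n

  instance
    n≢0 : ℕ.NonZero n
    n≢0 = ℕ.>-nonZero 1≤n

  q<n^q : ∀ q → q < n ^ q
  q<n^q zero    = s≤s z≤n
  q<n^q (suc q) = begin
    suc (suc q)     ≤⟨ s≤s (q<n^q q) ⟩
    1 + n ^ q       ≤⟨ +-monoˡ-≤ (n ^ q) (m^n>0 n q) ⟩
    n ^ q + n ^ q   ≡⟨ cong (n ^ q +_) (sym (+-identityʳ (n ^ q))) ⟩
    2 * n ^ q       ≤⟨ *-monoˡ-≤ (n ^ q) 2≤n ⟩
    n ^ suc q       ∎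
    where open ≤-Reasoning

  n≤n^q : ∀ q → 1 ≤ q → n ≤ n ^ q
  n≤n^q (suc q) _ = ≤-trans (≤-reflexive (sym (*-identityʳ n))) (*-monoʳ-≤ n (m^n>0 n q))

  cube : 1 + 3 * n ≤ n * n * n
  cube = begin
    1 + 3 * n   ≤⟨ +-monoˡ-≤ (3 * n) 1≤n ⟩
    4 * n       ≤⟨ *-monoˡ-≤ n (*-mono-≤ 2≤n 2≤n) ⟩
    n * n * n   ∎
    where open ≤-Reasoning

  branches : (1 + 3 * n) ^ q ≤ 4 * (n ^ q * n ^ q * n ^ q)
  branches = begin
    (1 + 3 * n) ^ q               ≤⟨ ^-monoˡ-≤ q cube ⟩
    (n * n * n) ^ q               ≡⟨ ^-distribʳ-* (n * n) n q ⟩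
    (n * n) ^ q * n ^ q           ≡⟨ cong (_* n ^ q) (^-distribʳ-* n n q) ⟩
    n ^ q * n ^ q * n ^ q         ≤⟨ m≤m+n _ _ ⟩
    4 * (n ^ q * n ^ q * n ^ q)   ∎
    where open ≤-Reasoning

-- For n ≤ 1 the powers of n do not grow, but then q is at most n.
dominated : ∀ n q → (n ≡ 0 → q ≡ 0) → (n ≡ 1 → q ≤ 1) → Dominated n q
dominated 0 q h₀ h₁ with refl ← h₀ refl = record
  { depth-≤ = z≤n ; vars-≤ = λ () ; branches-≤ = s≤s z≤n }
dominated 1 q h₀ h₁ with h₁ refl
... | z≤n     = record { depth-≤ = z≤n ; vars-≤ = λ () ; branches-≤ = s≤s z≤n }
... | s≤s z≤n = record { depth-≤ = ≤-refl ; vars-≤ = λ _ → ≤-refl ; branches-≤ = ≤-refl }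
dominated (suc (suc n-2)) q h₀ h₁ = dominated-≥2 (suc (suc n-2)) q (s≤s (s≤s z≤n))

module _ (𝓔 : ErrorMetric) (natural : Natural 𝓔) where

  minimum-0 : ∀ (R : RDT 0) {ε q} → IsMinimum (Achievable 𝓔 R ε) q → q ≡ 0
  minimum-0 R m = n≤0⇒n≡0 (IsMinimum.least m (shallow (IsMinimum.member m)))
    where
    shallow : ∀ {ε q} → Achievable 𝓔 R ε q → Achievable 𝓔 R ε 0
    shallow (D , _ , small) = D , ≤-reflexive (no-queries (tree D)) , small
      where
      no-queries : (T : RDT 0) → queries T ≡ 0
      no-queries (leaf _)     = refl
      no-queries (coin T₀ T₁) = cong₂ _⊔_ (no-queries T₀) (no-queries T₁)

  -- On one variable, any tree is equivalent to a single query.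
  minimum-1 : ∀ (R : RDT 1) {ε q} → IsMinimum (Achievable 𝓔 R ε) q → q ≤ 1
  minimum-1 R m = IsMinimum.least m (shallow (IsMinimum.member m))
    where
    D′ : DDT 1 → DDT 1
    D′ D = queryᴰ zero (const (⟦ D ⟧ᴰ (false ∷ []))) (const (⟦ D ⟧ᴰ (true ∷ [])))

    agree : ∀ D x → ⟦ D ⟧ᴰ x ≡ ⟦ D′ D ⟧ᴰ x
    agree D (false ∷ []) = refl
    agree D (true ∷ [])  = refl

    shallow : ∀ {ε q} → Achievable 𝓔 R ε q → Achievable 𝓔 R ε 1
    shallow {ε} (D , _ , small) = D′ D , ≤-refl ,
      subst (ℚ._≤ ε) (error-cong 𝓔 natural R {D} {D′ D} (agree D)) small

module Search (t : ℕ → ℕ) (𝓔 : ErrorMetric) (natural : Natural 𝓔) (efficient : Efficient t 𝓔) where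

  open Algorithm t 𝓔 natural efficient

  -- Input cons K (cons R ε): builds an optimal tree for the stack K and returns
  -- it if its error is at most ε; otherwise repeats with one more level.  The
  -- variables are enumerated only in the second case: n may be exponential in
  -- the description length of R, and n ^ q⋆ bounds n only if q⋆ is positive.
  searchP : Program
  searchP = case v0 nil (case v1 nil (case v0 nil
    (let′ (call buildP (cons v4 v2))
    (let′ (call leqP (cons (call evaluateP (cons v3 (cons v1 v0))) v4))
      (case v0
        (self (cons (cons (call varsP v2) v6) (cons v4 v5)))
        (cons v4 v3))))))

  instanceOptP : Program
  instanceOptP = call searchP (cons nil v0)

  -- N, τ, W, E stand for the four parameters of the running time; κ and Y bound
  -- the stacks of the search and the activations of buildP on them.
  N τ W E κ Y scoreT searchS searchT : Poly 4
  N = var zero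
  τ = var (suc zero)
  W = var (suc (suc zero))
  E = var (suc (suc (suc zero)))
  κ = con 1 ⊕ W ⊗ (con 2 ⊕ W ⊗ (con 2 ⊕ con 4 ⊗ W))
  Y = con 4 ⊗ (W ⊗ W ⊗ W)
  scoreT  = evaluateT N τ κ Y
  searchS = con 1 ⊕ (κ ⊕ (con 1 ⊕ (N ⊕ E))) ⊕ buildT N τ κ Y ⊕ scoreT ⊕
            leqT (scoreT ⊕ E) ⊕ varsT W
  searchT = activations searchP (con 1 ⊕ W) searchS

  instanceOptT : Poly 4
  instanceOptT = activations instanceOptP (con 1) (searchT ⊕ (N ⊕ E ⊕ con 1))

  module _ {n : ℕ} (q : ℕ) (R : RDT n) (ε : ℚ) (hq : queries R ≤ q) (ε≥0 : 0ℚ ℚ.≤ ε)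
           (q⋆ : ℕ) (minimal : IsMinimum (Achievable 𝓔 R ε) q⋆) where

    open IsMinimum minimal

    bounds : Dominated n q⋆
    bounds = dominated n q⋆ (λ { refl → minimum-0 𝓔 natural R minimal })
                            (λ { refl → minimum-1 𝓔 natural R minimal })

    open Dominated bounds

    a : Vec ℕ 4
    a = descriptionLength R ∷ t q ∷ n ^ q⋆ ∷ size (encℚ ε) ∷ []

    open Build {a = a} N τ κ Y {n} q ≤-refl hiding (s; input)

    s : ℕ
    s = ⟦ searchS ⟧ᴾ a

    stack-≤ : ∀ j → j ≤ q⋆ → size (encStack (fullStack n j)) ≤ ⟦ κ ⟧ᴾ a
    stack-≤ zero    _ = s≤s z≤n
    stack-≤ j@(suc _) j≤q = ≤-trans (size-fullStack n j)
      (s≤s (*-mono-≤ (≤-trans j≤q depth-≤)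
        (+-monoʳ-≤ 2 (*-mono-≤ n≤w (+-monoʳ-≤ 2 (*-monoʳ-≤ 4 n≤w))))))
      where
      n≤w : n ≤ n ^ q⋆
      n≤w = vars-≤ (≤-trans (s≤s z≤n) j≤q)

    calls-≤ : ∀ j → j ≤ q⋆ → calls (fullStack n j) ≤ ⟦ Y ⟧ᴾ a
    calls-≤ j j≤q = ≤-trans (calls-fullStack n j)
      (≤-trans (^-monoʳ-≤ (1 + 3 * n) j≤q) branches-≤)

    within : ∀ j → j ≤ q⋆ → Within (fullStack n j) R
    within j j≤q = hq , ≤-refl , stack-≤ j j≤q , calls-≤ j j≤q

    state : ℕ → Tree
    state j = cons (encStack (fullStack n j)) (cons (describe R) (encℚ ε))

    Found : ℕ → ℕ → Set
    Found j c = Σ[ D ∈ DDT n ] queries (tree D) ≤ q⋆ × error 𝓔 R D ℚ.≤ ε ×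
                searchP at s on state j returns describe (tree D) after c

    -- By induction on the number d of levels that may still be added.
    search : ∀ d j → d + j ≡ q⋆ → Found j (suc d)
    search d j d+j≡q = explore (build-time (fullStack n j) R (within j j≤q))
      where
      j≤q : j ≤ q⋆
      j≤q = ≤-trans (m≤n+m j d) (≤-reflexive d+j≡q)

      explore : Σ[ D ∈ DDT n ] Optimal 𝓔 (fullStack n j) R D ×
                  size (encRDT (tree D)) ≤ ⟦ treeZ N τ κ Y ⟧ᴾ a ×
                  buildP on cons (encStack (fullStack n j)) (describe R)
                    returns encRDT (tree D) within ⟦ buildT N τ κ Y ⟧ᴾ a →
                Found j (suc d)
      explore (D , (allowed , best) , D≤ , r) = decide d d+j≡q (error 𝓔 R D ℚₚ.≤? ε) compare
        where
        input : size (state j) ≤ s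
        input = ≤-trans (s≤s (+-monoˡ-≤ _ (stack-≤ j j≤q)))
          (⊴-≤ {P = con 1 ⊕ (κ ⊕ (con 1 ⊕ (N ⊕ E)))} searchS (left (left (left (left here)))))

        tree-built : buildP on cons (encStack (fullStack n j)) (describe R)
                       returns encRDT (tree D) within s
        tree-built = weaken (⊴-≤ searchS (left (left (left (right here))))) r

        score : evaluateP on cons (describe R) (describe (tree D))
                  returns encℚ (error 𝓔 R D) within ⟦ scoreT ⟧ᴾ a
        score = evaluation R D hq ≤-refl D≤

        compare : leqP on cons (encℚ (error 𝓔 R D)) (encℚ ε)
                    returns encBool (does (error 𝓔 R D ℚₚ.≤? ε)) within s
        compare = weaken (⊴-≤ searchS (left (right here)))
          (leqP-correct (scoreT ⊕ E) _ ε (0≤value (𝓔 R D)) ε≥0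
            (≤-trans (output-size score) (m≤m+n _ _)) (m≤n+m _ _))

        -- One activation, given the evaluation of the final case on the flag.
        step : ∀ {flag v c} →
          leqP on cons (encℚ (error 𝓔 R D)) (encℚ ε) returns flag within s →
          searchP at s ∣ flag ∷ encRDT (tree D) ∷ encℕ n ∷ encRDT R ∷ describe R ∷ encℚ ε ∷
            encStack (fullStack n j) ∷ cons (describe R) (encℚ ε) ∷ state j ∷ []
            ⊢ case v0 (self (cons (cons (call varsP v2) v6) (cons v4 v5))) (cons v4 v3)
            ⇓ v ⟨ c ⟩ →
          searchP at s on state j returns v after suc c
        step cmp rest = activate input
          (↓case-cons refl (↓case-cons refl (↓case-cons refl
            (↓let (output-size tree-built) (↓call (↓cons (↓var _) (↓var _)) tree-built)
            (↓let (output-size cmp)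
              (↓call (↓cons (↓call (↓cons (↓var _) (↓cons (↓var _) (↓var _)))
                              (weaken (⊴-≤ searchS (left (left (right here)))) score))
                            (↓var _)) cmp)
              rest)))))
          ≤-refl

        decide : ∀ d → d + j ≡ q⋆ → (D≤ε? : Dec (error 𝓔 R D ℚ.≤ ε)) →
                 leqP on cons (encℚ (error 𝓔 R D)) (encℚ ε)
                   returns encBool (does D≤ε?) within s →
                 Found j (suc d)
        decide d eq (yes D≤ε) cmp = D ,
          ≤-trans (allowed-queries allowed) (≤-trans (≤-reflexive (Listₚ.length-replicate j)) j≤q) ,
          D≤ε ,
          after-≤ (s≤s z≤n) (step cmp (↓case-cons refl (↓cons (↓var _) (↓var _))))
        -- With q⋆ levels an achieving tree is allowed, so the search has stopped.
        decide zero eq (no D≰ε) cmp = contradiction reached D≰ε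
          where
          reached : error 𝓔 R D ℚ.≤ ε
          reached = let D⋆ , q≤ , small = member in ℚₚ.≤-trans
            (best D⋆ (allowed-replicate (coinFree D⋆) (≤-trans q≤ (≤-reflexive (sym eq))))) small
        decide (suc d) eq (no D≰ε) cmp =
          let D′ , q≤ , small , r′ = search d (suc j) (trans (+-suc d j) eq) in
          D′ , q≤ , small , step cmp
            (↓case-nil refl
              (↓self (↓cons (↓cons (↓call (↓var _) variables) (↓var _)) (↓cons (↓var _) (↓var _))) r′))
          where
          variables : varsP on encℕ n returns encVars (allVars n) within s
          variables = weaken (⊴-≤ searchS (right here))
            (varsP-correct W n (vars-≤ (≤-trans (s≤s z≤n) (≤-trans (m≤m+n (suc d) j) (≤-reflexive eq)))))

    instanceOpt : Σ[ D ∈ DDT n ]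
      (instanceOptP on cons (describe R) (encℚ ε) returns describe (tree D)
         within ⟦ instanceOptT ⟧ᴾ a) ×
      queries (tree D) ≤ q⋆ × error 𝓔 R D ℚ.≤ ε
    instanceOpt = let D , q≤ , small , r = search q⋆ 0 (+-identityʳ q⋆) in
      D ,
      total (con 1) (searchT ⊕ (N ⊕ E ⊕ con 1))
        (activate (≤-trans (≤-reflexive (+-comm 1 _)) (m≤n+m _ (⟦ searchT ⟧ᴾ a)))
          (↓call (↓cons ↓nil (↓var _))
            (weaken (m≤m+n _ _) (total (con 1 ⊕ W) searchS r (s≤s depth-≤))))
          ≤-refl)
        ≤-refl ,
      q≤ , small

theorem3 : (t : ℕ → ℕ) (𝓔 : ErrorMetric) → Natural 𝓔 → Efficient t 𝓔 →
    Σ[ A ∈ Program ] Σ[ P ∈ Poly 4 ]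
    (∀ {n} q (R : RDT n) (ε : ℚ) → queries R ℕ.≤ q → 0ℚ ℚ.< ε → ε ℚ.< 1ℚ →
    ∀ q⋆ → IsMinimum (Achievable 𝓔 R ε) q⋆ →
    Σ[ D ∈ DDT n ]
    (A on cons (describe R) (encℚ ε) returns describe (tree D)
    within ⟦ P ⟧ᴾ (descriptionLength R ∷ t q ∷ n ^ q⋆ ∷ size (encℚ ε) ∷ []))
    × queries (tree D) ℕ.≤ q⋆
    × value (𝓔 R D) ℚ.≤ ε)
theorem3 t 𝓔 natural efficient = instanceOptP , instanceOptT ,
  λ q R ε hq 0<ε _ q⋆ minimal → instanceOpt q R ε hq (ℚₚ.<⇒≤ 0<ε) q⋆ minimal
  where open Search t 𝓔 natural efficient
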